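{- Let $\lambda\in\mathbb{R}\setminus\{0\}$, $k\in\mathbb{Z}$, $u\in\mathbb{C}$ with $u\neq1$, and $x,y\in\mathbb{R}$. Then for every integer $n\ge0$, \[ 2\Big\{\sum_{l=0}^{n}\binom{n}{l}(1)_{n-l,\lambda}FG_{l,\lambda}^{[k,c]}(x,y;u)-u\,FG_{n,\lambda}^{[k,c]}(x,y;u)\Big\} =(1-u)\,n\sum_{m=0}^{n-1}\frac{\binom{n-1}{m}}{m+1}\sum_{j=1}^{m+1}\frac{(1)_{j,\lambda}}{j^{k-1}}S_{1,\lambda}(m+1,j)\sum_{l=0}^{n-1-m}\binom{n-1-m}{l}(x)_{n-1-m-l,\lambda}\big((iy)_{l,\lambda}+(-iy)_{l,\lambda}\big) \] and \[ 2i\Big\{\sum_{l=0}^{n}\binom{n}{l}(1)_{n-l,\lambda}FG_{l,\lambda}^{[k,s]}(x,y;u)-u\,FG_{n,\lambda}^{[k,s]}(x,y;u)\Big\} =(1-u)\,n\sum_{m=0}^{n-1}\frac{\binom{n-1}{m}}{m+1}\sum_{j=1}^{m+1}\frac{(1)_{j,\lambda}}{j^{k-1}}S_{1,\lambda}(m+1,j)\sum_{l=0}^{n-1-m}\binom{n-1-m}{l}(x)_{n-1-m-l,\lambda}\big((iy)_{l,\lambda}-(-iy)_{l,\lambda}\big). \]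
   Context: All generating functions are formal power series in $t$. For $z\in\mathbb{C}$: $(z)_{0,\lambda}=1$ and $(z)_{n,\lambda}=z(z-\lambda)\cdots(z-(n-1)\lambda)$ for $n\ge1$. The degenerate exponential is $e_\lambda^{z}(t)=\sum_{n\ge0}(z)_{n,\lambda}\frac{t^n}{n!}$ (i.e. $(1+\lambda t)^{z/\lambda}$), and $e_\lambda(t)=e_\lambda^{1}(t)$. Also $\log_\lambda(1+t)=\frac{1}{\lambda}\big((1+t)^\lambda-1\big)$. The degenerate Stirling numbers of the first kind are defined by $\frac{1}{j!}(\log_\lambda(1+t))^j=\sum_{n\ge j}S_{1,\lambda}(n,j)\frac{t^n}{n!}$. The modified degenerate polyexponential function is $\mathrm{Ei}_{k,\lambda}(x)=\sum_{n\ge1}\frac{(1)_{n,\lambda}}{n^k(n-1)!}x^n$. The degenerate cosine and sine are $\cos_\lambda^{(y)}(t)=\frac{e_\lambda^{iy}(t)+e_\lambda^{ -iy}(t)}{2}$ and $\sin_\lambda^{(y)}(t)=\frac{e_\lambda^{iy}(t)-e_\lambda^{ -iy}(t)}{2i}$. The cosine and sine degenerate poly-Frobenius-Genocchi polynomials are defined by $\sum_{n\ge0}FG_{n,\lambda}^{[k,c]}(x,y;u)\frac{t^n}{n!}=\frac{(1-u)\mathrm{Ei}_{k,\lambda}(\log_\lambda(1+t))}{e_\lambda(t)-u}e_\lambda^{x}(t)\cos_\lambda^{(y)}(t)$ and $\sum_{n\ge0}FG_{n,\lambda}^{[k,s]}(x,y;u)\frac{t^n}{n!}=\frac{(1-u)\mathrm{Ei}_{k,\lambda}(\log_\lambda(1+t))}{e_\lambda(t)-u}e_\lambda^{x}(t)\sin_\lambda^{(y)}(t)$.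 -}

module Defs where

open import Algebra.Apartness.Bundles using (HeytingField)
open import Algebra.Bundles using (CommutativeRing)
open import Data.Nat.Base as ℕ using (ℕ; zero; suc; _∸_; _!)
open import Data.Nat.Properties as ℕₚ using (_!≢0)
open import Data.Integer.Base as ℤ using (ℤ; +_; -[1+_])
open import Data.Rational.Base as Rat using (ℚ; 0ℚ; 1ℚ; ½; ∣_∣)
open import Data.Rational.Properties as ℚₚ using ()
open import Data.Fin.Base using (toℕ)
open import Data.Vec.Base using (Vec; []; _∷_; head; lookup)
open import Data.Product.Base using (∃-syntax; _×_; _,_)
open import Data.Sum.Base as Sum using (_⊎_; inj₁; inj₂)
open import Level using (0ℓ)
open import Relation.Binary.PropositionalEquality using (_≡_; refl; sym; trans; cong; cong₂; subst; subst₂)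
open import Relation.Nullary using (¬_; yes; no; contradiction)

module RationalLemmas where

  open Rat using (_+_; _*_; _-_; -_; _<_; _≤_)
  open import Data.Rational.Solver using (module +-*-Solver)
  open +-*-Solver using (solve; con; _:+_; _:*_; _:-_; :-_; _:=_)

  half : ℚ → ℚ
  half ε = ½ * ε

  half>0 : ∀ {ε} → 0ℚ < ε → 0ℚ < half ε
  half>0 {ε} ε>0 = ℚₚ.positive⁻¹ _ {{ℚₚ.pos*pos⇒pos ½ ε {{Rat.positive ε>0}}}}

  half+half : ∀ ε → half ε + half ε ≡ ε
  half+half = solve 1 (λ e → con ½ :* e :+ con ½ :* e := e) refl

  <-halves : ∀ {p q} ε → p < half ε → q < half ε → p + q < ε
  <-halves ε p< q< = subst (_ <_) (half+half ε) (ℚₚ.+-mono-< p< q<)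

  *>0 : ∀ {p q} → 0ℚ < p → 0ℚ < q → 0ℚ < p * q
  *>0 {p} {q} p>0 q>0 = ℚₚ.positive⁻¹ _ {{ℚₚ.pos*pos⇒pos p {{Rat.positive p>0}} q {{Rat.positive q>0}}}}

  ∣p-p∣≡0 : ∀ p → ∣ p - p ∣ ≡ 0ℚ
  ∣p-p∣≡0 p = cong ∣_∣ (ℚₚ.+-inverseʳ p)

  ∣p-q∣≡∣q-p∣ : ∀ p q → ∣ p - q ∣ ≡ ∣ q - p ∣
  ∣p-q∣≡∣q-p∣ p q = trans (sym (ℚₚ.∣-p∣≡∣p∣ (p - q)))
    (cong ∣_∣ (solve 2 (λ a b → :- (a :- b) := b :- a) refl p q))

  triangle : ∀ p q r → ∣ p - r ∣ ≤ ∣ p - q ∣ + ∣ q - r ∣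
  triangle p q r = subst (λ s → ∣ s ∣ ≤ ∣ p - q ∣ + ∣ q - r ∣)
    (solve 3 (λ a b c → (a :- b) :+ (b :- c) := a :- c) refl p q r)
    (ℚₚ.∣p+q∣≤∣p∣+∣q∣ (p - q) (q - r))

  +-close : ∀ a b c d ε → ∣ a - c ∣ < half ε → ∣ b - d ∣ < half ε →
            ∣ (a + b) - (c + d) ∣ < ε
  +-close a b c d ε a~c b~d = ℚₚ.≤-<-trans
    (subst (λ s → ∣ s ∣ ≤ ∣ a - c ∣ + ∣ b - d ∣)
      (solve 4 (λ a b c d → (a :- c) :+ (b :- d) := (a :+ b) :- (c :+ d)) refl a b c d)
      (ℚₚ.∣p+q∣≤∣p∣+∣q∣ (a - c) (b - d)))
    (<-halves ε a~c b~d)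

  -‿close : ∀ a b ε → ∣ a - b ∣ < ε → ∣ (- a) - (- b) ∣ < ε
  -‿close a b ε a~b = subst (_< ε)
    (trans (∣p-q∣≡∣q-p∣ a b) (cong ∣_∣ (solve 2 (λ a b → b :- a := (:- a) :- (:- b)) refl a b)))
    a~b

  quot : ∀ p B → 0ℚ < B → ℚ
  quot p B B>0 = p * (Rat.1/ B) {{Rat.>-nonZero B>0}}

  quot>0 : ∀ {p B} → 0ℚ < p → (B>0 : 0ℚ < B) → 0ℚ < quot p B B>0
  quot>0 {p} {B} p>0 B>0 = *>0 p>0
    (ℚₚ.positive⁻¹ _ {{ℚₚ.1/pos⇒pos B {{Rat.positive B>0}}}})

  *-quot : ∀ p B (B>0 : 0ℚ < B) → B * quot p B B>0 ≡ p
  *-quot p B B>0 =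
    trans (solve 3 (λ p b c → b :* (p :* c) := p :* (b :* c)) refl p B _)
    (trans (cong (p *_) (ℚₚ.*-inverseʳ B {{Rat.>-nonZero B>0}})) (ℚₚ.*-identityʳ p))

  *-mono-<-nonNeg : ∀ {p q B δ} → 0ℚ ≤ p → 0ℚ < δ → p < B → q < δ → p * q < B * δ
  *-mono-<-nonNeg {p} {q} {B} {δ} p≥0 δ>0 p<B q<δ = ℚₚ.≤-<-trans
    (ℚₚ.*-monoˡ-≤-nonNeg p {{Rat.nonNegative p≥0}} (ℚₚ.<⇒≤ q<δ))
    (ℚₚ.*-monoˡ-<-pos δ {{Rat.positive δ>0}} p<B)

  *-mono-≤-nonNeg : ∀ {p q r s} → 0ℚ ≤ p → 0ℚ ≤ s → p ≤ r → q ≤ s → p * q ≤ r * s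
  *-mono-≤-nonNeg {p} {q} {r} {s} p≥0 s≥0 p≤r q≤s = ℚₚ.≤-trans
    (ℚₚ.*-monoˡ-≤-nonNeg p {{Rat.nonNegative p≥0}} q≤s)
    (ℚₚ.*-monoʳ-≤-nonNeg s {{Rat.nonNegative s≥0}} p≤r)

  *-close : ∀ a b c d ε {A D} (ε>0 : 0ℚ < ε) (A>0 : 0ℚ < A) (D>0 : 0ℚ < D) →
            ∣ a ∣ < A → ∣ d ∣ < D →
            ∣ a - c ∣ < quot (half ε) D D>0 → ∣ b - d ∣ < quot (half ε) A A>0 →
            ∣ (a * b) - (c * d) ∣ < ε
  *-close a b c d ε {A} {D} ε>0 A>0 D>0 a<A d<D a~c b~d = ℚₚ.≤-<-trans
    (subst₂ _≤_
      (cong ∣_∣ (solve 4 (λ a b c d → a :* (b :- d) :+ d :* (a :- c) := a :* b :- c :* d) refl a b c d))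
      (cong₂ _+_ (ℚₚ.∣p*q∣≡∣p∣*∣q∣ a (b - d)) (ℚₚ.∣p*q∣≡∣p∣*∣q∣ d (a - c)))
      (ℚₚ.∣p+q∣≤∣p∣+∣q∣ (a * (b - d)) (d * (a - c))))
    (<-halves ε
      (subst (_ <_) (*-quot (half ε) A A>0)
        (*-mono-<-nonNeg (ℚₚ.0≤∣p∣ a) (quot>0 (half>0 ε>0) A>0) a<A b~d))
      (subst (_ <_) (*-quot (half ε) D D>0)
        (*-mono-<-nonNeg (ℚₚ.0≤∣p∣ d) (quot>0 (half>0 ε>0) D>0) d<D a~c)))

  -- reciprocal with the convention 1/0 = 0
  recip : ℚ → ℚ
  recip p with p ℚₚ.≟ 0ℚ
  ... | yes _  = 0ℚ
  ... | no p≢0 = (Rat.1/ p) {{Rat.≢-nonZero p≢0}}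

  recip-inverse : ∀ {p δ} → 0ℚ < δ → δ ≤ ∣ p ∣ → p * recip p ≡ 1ℚ
  recip-inverse {p} δ>0 δ≤∣p∣ with p ℚₚ.≟ 0ℚ
  ... | yes refl = contradiction (ℚₚ.<-≤-trans δ>0 δ≤∣p∣) (ℚₚ.<-irrefl refl)
  ... | no p≢0   = ℚₚ.*-inverseʳ p {{Rat.≢-nonZero p≢0}}

  recip-bound : ∀ {p δ} → 0ℚ < δ → δ ≤ ∣ p ∣ → ∣ recip p ∣ * δ ≤ 1ℚ
  recip-bound {p} {δ} δ>0 δ≤∣p∣ = subst (∣ recip p ∣ * δ ≤_)
    (trans (sym (ℚₚ.∣p*q∣≡∣p∣*∣q∣ (recip p) p))
      (cong ∣_∣ (trans (ℚₚ.*-comm (recip p) p) (recip-inverse δ>0 δ≤∣p∣))))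
    (ℚₚ.*-monoˡ-≤-nonNeg ∣ recip p ∣ {{ℚₚ.∣-∣-nonNeg (recip p)}} δ≤∣p∣)

  recip-close : ∀ {p q δ} ε → 0ℚ < δ → δ ≤ ∣ p ∣ → δ ≤ ∣ q ∣ →
                ∣ p - q ∣ < ε * (δ * δ) → ∣ recip p - recip q ∣ < ε
  recip-close {p} {q} {δ} ε δ>0 δ≤∣p∣ δ≤∣q∣ p~q =
    ℚₚ.*-cancelʳ-<-nonNeg (δ * δ) {{Rat.nonNegative (ℚₚ.<⇒≤ (*>0 δ>0 δ>0))}}
      (ℚₚ.≤-<-trans scaled p~q)
    where
    rp rq : ℚ
    rp = recip p
    rq = recip q
    difference : (rp * rq) * (q - p) ≡ rp - rq
    difference =
      trans (solve 4 (λ p q rp rq → (rp :* rq) :* (q :- p) := rp :* (q :* rq) :- rq :* (p :* rp)) refl p q rp rq)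
      (trans (cong₂ (λ s t → rp * s - rq * t) (recip-inverse δ>0 δ≤∣q∣) (recip-inverse δ>0 δ≤∣p∣))
        (solve 2 (λ rp rq → rp :* con 1ℚ :- rq :* con 1ℚ := rp :- rq) refl rp rq))
    modulus : ∣ rp - rq ∣ * (δ * δ) ≡ ((∣ rp ∣ * δ) * (∣ rq ∣ * δ)) * ∣ p - q ∣
    modulus =
      trans (cong (λ s → ∣ s ∣ * (δ * δ)) (sym difference))
      (trans (cong (_* (δ * δ)) (trans (ℚₚ.∣p*q∣≡∣p∣*∣q∣ (rp * rq) (q - p))
               (cong₂ _*_ (ℚₚ.∣p*q∣≡∣p∣*∣q∣ rp rq) (∣p-q∣≡∣q-p∣ q p))))
        (solve 4 (λ x y m d → ((x :* y) :* m) :* (d :* d) := ((x :* d) :* (y :* d)) :* m)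
          refl (∣ rp ∣) (∣ rq ∣) (∣ p - q ∣) δ))
    δ≥0 : Rat.NonNegative δ
    δ≥0 = Rat.nonNegative (ℚₚ.<⇒≤ δ>0)
    factor≥0 : ∀ r → 0ℚ ≤ ∣ r ∣ * δ
    factor≥0 r = ℚₚ.nonNegative⁻¹ _ {{ℚₚ.nonNeg*nonNeg⇒nonNeg ∣ r ∣ {{ℚₚ.∣-∣-nonNeg r}} δ {{δ≥0}}}}
    scaled : ∣ rp - rq ∣ * (δ * δ) ≤ ∣ p - q ∣
    scaled = subst₂ _≤_ (sym modulus) (ℚₚ.*-identityˡ ∣ p - q ∣)
      (ℚₚ.*-monoʳ-≤-nonNeg ∣ p - q ∣ {{ℚₚ.∣-∣-nonNeg (p - q)}}
        (*-mono-≤-nonNeg {r = 1ℚ} {s = 1ℚ} (factor≥0 rp) (ℚₚ.nonNegative⁻¹ 1ℚ)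
          (recip-bound δ>0 δ≤∣p∣) (recip-bound δ>0 δ≤∣q∣)))

  split-≥ : ∀ {p q} ε → ε ≤ p + q → half ε ≤ p ⊎ half ε ≤ q
  split-≥ {p} {q} ε ε≤ with half ε ℚₚ.≤? p | half ε ℚₚ.≤? q
  ... | yes h≤p | _       = inj₁ h≤p
  ... | no _    | yes h≤q = inj₂ h≤q
  ... | no h≰p  | no h≰q  =
    contradiction (ℚₚ.<-≤-trans (<-halves ε (ℚₚ.≰⇒> h≰p) (ℚₚ.≰⇒> h≰q)) ε≤) (ℚₚ.<-irrefl refl)

  ≥-half : ∀ {q r} p → p ≤ q + r → r < half p → half p ≤ q
  ≥-half p p≤ r< with split-≥ p p≤
  ... | inj₁ h≤q = h≤q
  ... | inj₂ h≤r = contradiction (ℚₚ.<-≤-trans r< h≤r) (ℚₚ.<-irrefl refl)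

-- ℝ is the setoid of Cauchy sequences of rationals modulo null sequences.  ℝ and
-- ℂ have no η-equality so that unification treats their operations as rigid.
module Real where

  open RationalLemmas
  open import Data.Rational.Solver using (module +-*-Solver)
  open +-*-Solver using (solve; con; _:+_; _:*_; _:-_; :-_; _:=_)

  TailWithin : (ℕ → ℚ) → ℚ → Set
  TailWithin s ε = ∃[ N ] (∀ m n → N ℕ.≤ m → N ℕ.≤ n → ∣ s m Rat.- s n ∣ Rat.< ε)

  record ℝ : Set where
    no-eta-equality
    field
      seq    : ℕ → ℚ
      cauchy : ∀ ε → 0ℚ Rat.< ε → TailWithin seq ε

  open ℝ public

  Eventually : (ℕ → Set) → Set
  Eventually P = ∃[ N ] (∀ n → N ℕ.≤ n → P n)

  infix 4 _≈_ _#_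

  record _≈_ (x y : ℝ) : Set where
    constructor mk≈
    field
      close : ∀ ε → 0ℚ Rat.< ε → Eventually (λ n → ∣ seq x n Rat.- seq y n ∣ Rat.< ε)

  -- The constructive form of x ≠ y: it is what makes x - y invertible, and by
  -- #-tight and #-irrefl its negation is equivalent to x ≈ y.
  record _#_ (x y : ℝ) : Set where
    constructor mk#
    field
      gap   : ℚ
      gap>0 : 0ℚ Rat.< gap
      apart : Eventually (λ n → gap Rat.≤ ∣ seq x n Rat.- seq y n ∣)

  open _≈_ public
  open _#_ public

  infixl 6 _+_ _-_
  infixl 7 _*_
  infix  8 -_

  private
    always : ∀ {P : ℕ → Set} → (∀ n → P n) → Eventually P
    always p = 0 , λ n _ → p n

    both : ∀ {P Q R : ℕ → Set} → (∀ n → P n → Q n → R n) → Eventually P → Eventually Q → Eventually R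
    both f (M , p) (N , q) = M ℕ.⊔ N , λ n MN≤n →
      f n (p n (ℕₚ.≤-trans (ℕₚ.m≤m⊔n M N) MN≤n)) (q n (ℕₚ.≤-trans (ℕₚ.m≤n⊔m M N) MN≤n))

    map : ∀ {P Q : ℕ → Set} → (∀ n → P n → Q n) → Eventually P → Eventually Q
    map f (N , p) = N , λ n N≤n → f n (p n N≤n)

    witness : ∀ {P : ℕ → Set} → Eventually P → ∃[ n ] P n
    witness (N , p) = N , p N ℕₚ.≤-refl

    -- a Cauchy sequence eventually stays ε-close to its tail
    settled : ∀ x ε → 0ℚ Rat.< ε →
              Eventually (λ m → Eventually (λ n → ∣ seq x m Rat.- seq x n ∣ Rat.< ε))
    settled x ε ε>0 with cauchy x ε ε>0
    ... | N , c = N , λ m N≤m → N , λ n N≤n → c m n N≤m N≤n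

    bounded : ∀ x → ∃[ B ] 0ℚ Rat.< B × Eventually (λ n → ∣ seq x n ∣ Rat.< B)
    bounded x with cauchy x 1ℚ (ℚₚ.positive⁻¹ 1ℚ)
    ... | N , c = 1ℚ Rat.+ ∣ seq x N ∣
      , ℚₚ.positive⁻¹ _ {{ℚₚ.pos+nonNeg⇒pos 1ℚ (∣ seq x N ∣) {{ℚₚ.∣-∣-nonNeg (seq x N)}}}}
      , N , λ n N≤n → ℚₚ.≤-<-trans
          (subst (λ s → ∣ s ∣ Rat.≤ ∣ seq x n Rat.- seq x N ∣ Rat.+ ∣ seq x N ∣)
            (solve 2 (λ a b → (a :- b) :+ b := a) refl (seq x n) (seq x N))
            (ℚₚ.∣p+q∣≤∣p∣+∣q∣ (seq x n Rat.- seq x N) (seq x N)))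
          (ℚₚ.+-monoˡ-< (∣ seq x N ∣) (c n N N≤n ℕₚ.≤-refl))

  fromℚ : ℚ → ℝ
  fromℚ q .seq _ = q
  fromℚ q .cauchy ε ε>0 = 0 , λ _ _ _ _ → subst (Rat._< ε) (sym (∣p-p∣≡0 q)) ε>0

  0# 1# : ℝ
  0# = fromℚ 0ℚ
  1# = fromℚ 1ℚ

  _+_ : ℝ → ℝ → ℝ
  (x + y) .seq n = seq x n Rat.+ seq y n
  (x + y) .cauchy ε ε>0 with cauchy x (half ε) (half>0 ε>0) | cauchy y (half ε) (half>0 ε>0)
  ... | M , c | N , d = M ℕ.⊔ N , λ m n ≤m ≤n →
    +-close (seq x m) (seq y m) (seq x n) (seq y n) ε
      (c m n (ℕₚ.m⊔n≤o⇒m≤o M N ≤m) (ℕₚ.m⊔n≤o⇒m≤o M N ≤n))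
      (d m n (ℕₚ.m⊔n≤o⇒n≤o M N ≤m) (ℕₚ.m⊔n≤o⇒n≤o M N ≤n))

  -_ : ℝ → ℝ
  (- x) .seq n = Rat.- seq x n
  (- x) .cauchy ε ε>0 with cauchy x ε ε>0
  ... | N , c = N , λ m n ≤m ≤n → -‿close (seq x m) (seq x n) ε (c m n ≤m ≤n)

  _-_ : ℝ → ℝ → ℝ
  x - y = x + (- y)

  private
    *-cauchy : ∀ (s t : ℕ → ℚ) ε (ε>0 : 0ℚ Rat.< ε) {A D} (A>0 : 0ℚ Rat.< A) (D>0 : 0ℚ Rat.< D) →
               Eventually (λ n → ∣ s n ∣ Rat.< A) → Eventually (λ n → ∣ t n ∣ Rat.< D) →
               TailWithin s (quot (half ε) D D>0) → TailWithin t (quot (half ε) A A>0) →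
               TailWithin (λ n → s n Rat.* t n) ε
    *-cauchy s t ε ε>0 A>0 D>0 (K , s<A) (L , t<D) (M , c) (N , d) =
      (K ℕ.⊔ L) ℕ.⊔ (M ℕ.⊔ N) , λ m n ≤m ≤n →
      let ≤m₁ = ℕₚ.m⊔n≤o⇒m≤o (K ℕ.⊔ L) (M ℕ.⊔ N) ≤m
          ≤m₂ = ℕₚ.m⊔n≤o⇒n≤o (K ℕ.⊔ L) (M ℕ.⊔ N) ≤m
          ≤n₁ = ℕₚ.m⊔n≤o⇒m≤o (K ℕ.⊔ L) (M ℕ.⊔ N) ≤n
          ≤n₂ = ℕₚ.m⊔n≤o⇒n≤o (K ℕ.⊔ L) (M ℕ.⊔ N) ≤n
      in *-close (s m) (t m) (s n) (t n) ε ε>0 A>0 D>0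
           (s<A m (ℕₚ.m⊔n≤o⇒m≤o K L ≤m₁)) (t<D n (ℕₚ.m⊔n≤o⇒n≤o K L ≤n₁))
           (c m n (ℕₚ.m⊔n≤o⇒m≤o M N ≤m₂) (ℕₚ.m⊔n≤o⇒m≤o M N ≤n₂))
           (d m n (ℕₚ.m⊔n≤o⇒n≤o M N ≤m₂) (ℕₚ.m⊔n≤o⇒n≤o M N ≤n₂))

  _*_ : ℝ → ℝ → ℝ
  (x * y) .seq n = seq x n Rat.* seq y n
  (x * y) .cauchy ε ε>0 =
    let A , A>0 , x<A = bounded x
        D , D>0 , y<D = bounded y
    in *-cauchy (seq x) (seq y) ε ε>0 A>0 D>0 x<A y<D
         (cauchy x _ (quot>0 (half>0 ε>0) D>0)) (cauchy y _ (quot>0 (half>0 ε>0) A>0))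

  inv : (x : ℝ) → x # 0# → ℝ
  inv x x#0 .seq n = recip (seq x n)
  inv x (mk# δ δ>0 (M , a)) .cauchy ε ε>0
    with cauchy x (ε Rat.* (δ Rat.* δ)) (*>0 ε>0 (*>0 δ>0 δ>0))
  ... | N , c = M ℕ.⊔ N , λ m n ≤m ≤n →
    recip-close ε δ>0 (away m (ℕₚ.m⊔n≤o⇒m≤o M N ≤m)) (away n (ℕₚ.m⊔n≤o⇒m≤o M N ≤n))
      (c m n (ℕₚ.m⊔n≤o⇒n≤o M N ≤m) (ℕₚ.m⊔n≤o⇒n≤o M N ≤n))
    where
    away : ∀ n → M ℕ.≤ n → δ Rat.≤ ∣ seq x n ∣
    away n M≤n = subst (δ Rat.≤_) (cong ∣_∣ (ℚₚ.+-identityʳ (seq x n))) (a n M≤n)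

  pointwise : ∀ {x y} → (∀ n → seq x n ≡ seq y n) → x ≈ y
  pointwise {x} {y} eq .close ε ε>0 = always λ n →
    subst (Rat._< ε) (sym (trans (cong (λ s → ∣ s Rat.- seq y n ∣) (eq n)) (∣p-p∣≡0 (seq y n)))) ε>0

  ≈-refl : ∀ {x} → x ≈ x
  ≈-refl = pointwise λ _ → refl

  ≈-sym : ∀ {x y} → x ≈ y → y ≈ x
  ≈-sym {x} {y} x≈y .close ε ε>0 =
    map (λ n → subst (Rat._< ε) (∣p-q∣≡∣q-p∣ (seq x n) (seq y n))) (close x≈y ε ε>0)

  ≈-trans : ∀ {x y z} → x ≈ y → y ≈ z → x ≈ z
  ≈-trans {x} {y} {z} x≈y y≈z .close ε ε>0 =
    both (λ n p q → ℚₚ.≤-<-trans (triangle (seq x n) (seq y n) (seq z n)) (<-halves ε p q))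
      (close x≈y (half ε) (half>0 ε>0)) (close y≈z (half ε) (half>0 ε>0))

  +-cong : ∀ {x y u v} → x ≈ y → u ≈ v → x + u ≈ y + v
  +-cong {x} {y} {u} {v} x≈y u≈v .close ε ε>0 =
    both (λ n → +-close (seq x n) (seq u n) (seq y n) (seq v n) ε)
      (close x≈y (half ε) (half>0 ε>0)) (close u≈v (half ε) (half>0 ε>0))

  -‿cong : ∀ {x y} → x ≈ y → - x ≈ - y
  -‿cong {x} {y} x≈y .close ε ε>0 = map (λ n → -‿close (seq x n) (seq y n) ε) (close x≈y ε ε>0)

  *-cong : ∀ {x y u v} → x ≈ y → u ≈ v → x * u ≈ y * v
  *-cong {x} {y} {u} {v} x≈y u≈v .close ε ε>0 =
    let A , A>0 , x<A = bounded x
        D , D>0 , v<D = bounded v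
    in both (λ n (x<A , v<D) (x~y , u~v) →
              *-close (seq x n) (seq u n) (seq y n) (seq v n) ε ε>0 A>0 D>0 x<A v<D x~y u~v)
         (both (λ _ → _,_) x<A v<D)
         (both (λ _ → _,_) (close x≈y _ (quot>0 (half>0 ε>0) D>0)) (close u≈v _ (quot>0 (half>0 ε>0) A>0)))

  commutativeRing : CommutativeRing 0ℓ 0ℓ
  commutativeRing = record
    { Carrier = ℝ ; _≈_ = _≈_ ; _+_ = _+_ ; _*_ = _*_ ; -_ = -_ ; 0# = 0# ; 1# = 1#
    ; isCommutativeRing = record
      { isRing = record
        { +-isAbelianGroup = record
          { isGroup = record
            { isMonoid = record
              { isSemigroup = record
                { isMagma = record
                  { isEquivalence = record { refl = ≈-refl ; sym = ≈-sym ; trans = ≈-trans }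
                  ; ∙-cong = +-cong }
                ; assoc = λ x y z → pointwise λ n → ℚₚ.+-assoc (seq x n) (seq y n) (seq z n) }
              ; identity = (λ x → pointwise λ n → ℚₚ.+-identityˡ (seq x n))
                         , (λ x → pointwise λ n → ℚₚ.+-identityʳ (seq x n)) }
            ; inverse = (λ x → pointwise λ n → ℚₚ.+-inverseˡ (seq x n))
                      , (λ x → pointwise λ n → ℚₚ.+-inverseʳ (seq x n))
            ; ⁻¹-cong = -‿cong }
          ; comm = λ x y → pointwise λ n → ℚₚ.+-comm (seq x n) (seq y n) }
        ; *-cong = *-cong
        ; *-assoc = λ x y z → pointwise λ n → ℚₚ.*-assoc (seq x n) (seq y n) (seq z n)
        ; *-identity = (λ x → pointwise λ n → ℚₚ.*-identityˡ (seq x n))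
                     , (λ x → pointwise λ n → ℚₚ.*-identityʳ (seq x n))
        ; distrib = (λ x y z → pointwise λ n → ℚₚ.*-distribˡ-+ (seq x n) (seq y n) (seq z n))
                  , (λ x y z → pointwise λ n → ℚₚ.*-distribʳ-+ (seq x n) (seq y n) (seq z n)) }
      ; *-comm = λ x y → pointwise λ n → ℚₚ.*-comm (seq x n) (seq y n) } }

  #-irrefl : ∀ {x y} → x ≈ y → ¬ x # y
  #-irrefl x≈y (mk# δ δ>0 a) with witness (both (λ _ → ℚₚ.≤-<-trans) a (close x≈y δ δ>0))
  ... | _ , δ<δ = ℚₚ.<-irrefl refl δ<δ

  #-sym : ∀ {x y} → x # y → y # x
  #-sym {x} {y} (mk# δ δ>0 a) =
    mk# δ δ>0 (map (λ n → subst (δ Rat.≤_) (∣p-q∣≡∣q-p∣ (seq x n) (seq y n))) a)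

  private
    -- one sufficiently late term decides apartness
    late-apart : ∀ x y δ → 0ℚ Rat.< δ → ∀ m → δ Rat.≤ ∣ seq x m Rat.- seq y m ∣ →
                 Eventually (λ n → ∣ seq x m Rat.- seq x n ∣ Rat.< half (half δ)) →
                 Eventually (λ n → ∣ seq y m Rat.- seq y n ∣ Rat.< half (half δ)) →
                 x # y
    late-apart x y δ δ>0 m δ≤ sx sy = mk# (half δ) (half>0 δ>0) (both step sx sy)
      where
      step : ∀ n → ∣ seq x m Rat.- seq x n ∣ Rat.< half (half δ) →
             ∣ seq y m Rat.- seq y n ∣ Rat.< half (half δ) →
             half δ Rat.≤ ∣ seq x n Rat.- seq y n ∣
      step n p q = ≥-half δ
        (ℚₚ.≤-trans δ≤ (subst (_ Rat.≤_)
          (solve 3 (λ a b c → a :+ (b :+ c) := b :+ (a :+ c)) refl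
            (∣ seq x m Rat.- seq x n ∣) (∣ seq x n Rat.- seq y n ∣) (∣ seq y n Rat.- seq y m ∣))
          (ℚₚ.≤-trans (triangle (seq x m) (seq x n) (seq y m))
            (ℚₚ.+-monoʳ-≤ (∣ seq x m Rat.- seq x n ∣) (triangle (seq x n) (seq y n) (seq y m))))))
        (<-halves (half δ) p (subst (Rat._< half (half δ)) (∣p-q∣≡∣q-p∣ (seq y m) (seq y n)) q))

  #-cotrans : ∀ {x y} → x # y → ∀ z → x # z ⊎ z # y
  #-cotrans {x} {y} (mk# δ δ>0 a) z =
    let m , δ≤ , sx , sy , sz = witness (both (λ _ → _,_) a (both (λ _ → _,_) (settled x ε ε>0)
                                  (both (λ _ → _,_) (settled y ε ε>0) (settled z ε ε>0))))
    in Sum.map (λ p → late-apart x z (half δ) (half>0 δ>0) m p sx sz)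
               (λ p → late-apart z y (half δ) (half>0 δ>0) m p sz sy)
               (split-≥ δ (ℚₚ.≤-trans δ≤ (triangle (seq x m) (seq z m) (seq y m))))
    where
    ε : ℚ
    ε = half (half (half δ))
    ε>0 : 0ℚ Rat.< ε
    ε>0 = half>0 (half>0 (half>0 δ>0))

  #-tight : ∀ x y → ¬ x # y → x ≈ y
  #-tight x y ¬x#y .close ε ε>0 =
    both step (settled x (half (half ε)) (half>0 (half>0 ε>0)))
              (settled y (half (half ε)) (half>0 (half>0 ε>0)))
    where
    step : ∀ m → Eventually (λ n → ∣ seq x m Rat.- seq x n ∣ Rat.< half (half ε)) →
           Eventually (λ n → ∣ seq y m Rat.- seq y n ∣ Rat.< half (half ε)) →
           ∣ seq x m Rat.- seq y m ∣ Rat.< ε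
    step m sx sy with ε ℚₚ.≤? ∣ seq x m Rat.- seq y m ∣
    ... | yes ε≤ = contradiction (late-apart x y ε ε>0 m ε≤ sx sy) ¬x#y
    ... | no ε≰  = ℚₚ.≰⇒> ε≰

  inv-inverseʳ : ∀ x (x#0 : x # 0#) → x * inv x x#0 ≈ 1#
  inv-inverseʳ x x#0@(mk# δ δ>0 a) .close ε ε>0 = map step a
    where
    step : ∀ n → δ Rat.≤ ∣ seq x n Rat.- 0ℚ ∣ → ∣ seq x n Rat.* recip (seq x n) Rat.- 1ℚ ∣ Rat.< ε
    step n δ≤ = subst (λ s → ∣ s Rat.- 1ℚ ∣ Rat.< ε)
      (sym (recip-inverse δ>0 (subst (δ Rat.≤_) (cong ∣_∣ (ℚₚ.+-identityʳ (seq x n))) δ≤))) ε>0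

  #⇒-#0 : ∀ {x y} → x # y → x - y # 0#
  #⇒-#0 {x} {y} (mk# δ δ>0 a) = mk# δ δ>0
    (map (λ n → subst (δ Rat.≤_) (cong ∣_∣ (sym (ℚₚ.+-identityʳ (seq x n Rat.- seq y n))))) a)

  -#0⇒# : ∀ {x y} → x - y # 0# → x # y
  -#0⇒# {x} {y} (mk# δ δ>0 a) = mk# δ δ>0
    (map (λ n → subst (δ Rat.≤_) (cong ∣_∣ (ℚₚ.+-identityʳ (seq x n Rat.- seq y n)))) a)

  #-respˡ : ∀ {x y z} → x ≈ y → x # z → y # z
  #-respˡ {y = y} x≈y x#z =
    Sum.[ (λ x#y → contradiction x#y (#-irrefl x≈y)) , (λ y#z → y#z) ] (#-cotrans x#z y)

  1#0 : 1# # 0#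
  1#0 = mk# 1ℚ (ℚₚ.positive⁻¹ 1ℚ) (always λ _ → ℚₚ.≤-refl)

  +#0 : ∀ {x y} → x + y # 0# → x # 0# ⊎ y # 0#
  +#0 {x} {y} x+y#0 = Sum.map₁ cancel (#-cotrans x+y#0 y)
    where
    cancel : x + y # y → x # 0#
    cancel (mk# δ δ>0 a) = mk# δ δ>0 (map (λ n → subst (δ Rat.≤_)
      (cong ∣_∣ (solve 2 (λ a b → (a :+ b) :- b := a :- con 0ℚ) refl (seq x n) (seq y n)))) a)

  *#0 : ∀ {x y} → x * y # 0# → y # 0#
  *#0 {x} {y} (mk# δ δ>0 a) =
    let B , B>0 , x<B = bounded x
    in mk# (quot δ B B>0) (quot>0 δ>0 B>0) (both (step B B>0) a x<B)
    where
    step : ∀ B (B>0 : 0ℚ Rat.< B) n → δ Rat.≤ ∣ seq x n Rat.* seq y n Rat.- 0ℚ ∣ → ∣ seq x n ∣ Rat.< B →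
           quot δ B B>0 Rat.≤ ∣ seq y n Rat.- 0ℚ ∣
    step B B>0 n δ≤ x<B = ℚₚ.*-cancelˡ-≤-pos B {{Rat.positive B>0}} (subst₂ Rat._≤_
      (sym (*-quot δ B B>0)) (cong (λ s → B Rat.* ∣ s ∣) (sym (ℚₚ.+-identityʳ (seq y n))))
      (ℚₚ.≤-trans δ≤ (subst (Rat._≤ B Rat.* ∣ seq y n ∣)
        (trans (sym (ℚₚ.∣p*q∣≡∣p∣*∣q∣ (seq x n) (seq y n)))
          (cong ∣_∣ (sym (ℚₚ.+-identityʳ (seq x n Rat.* seq y n)))))
        (ℚₚ.*-monoʳ-≤-nonNeg (∣ seq y n ∣) {{ℚₚ.∣-∣-nonNeg (seq y n)}} (ℚₚ.<⇒≤ x<B)))))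

  -‿#0 : ∀ {x} → - x # 0# → x # 0#
  -‿#0 {x} (mk# δ δ>0 a) = mk# δ δ>0 (map (λ n → subst (δ Rat.≤_)
    (trans (cong ∣_∣ (solve 1 (λ a → (:- a) :- con 0ℚ := :- (a :- con 0ℚ)) refl (seq x n)))
      (ℚₚ.∣-p∣≡∣p∣ (seq x n Rat.- 0ℚ)))) a)

  squares#0 : ∀ {x y} → x # 0# → x * x + y * y # 0#
  squares#0 {x} {y} (mk# δ δ>0 a) = mk# (δ Rat.* δ) (*>0 δ>0 δ>0) (map step a)
    where
    square≥0 : ∀ q → 0ℚ Rat.≤ q Rat.* q
    square≥0 q with ℚₚ.∣p∣≡p∨∣p∣≡-p (q Rat.* q)
    ... | inj₁ eq = ℚₚ.∣p∣≡p⇒0≤p eq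
    ... | inj₂ _  = subst (0ℚ Rat.≤_) (square≡ q) (ℚₚ.nonNegative⁻¹ _
      {{ℚₚ.nonNeg*nonNeg⇒nonNeg (∣ q ∣) {{ℚₚ.∣-∣-nonNeg q}} (∣ q ∣) {{ℚₚ.∣-∣-nonNeg q}}}})
      where
      square≡ : ∀ q → ∣ q ∣ Rat.* ∣ q ∣ ≡ q Rat.* q
      square≡ q with ℚₚ.∣p∣≡p∨∣p∣≡-p q
      ... | inj₁ eq = cong₂ Rat._*_ eq eq
      ... | inj₂ eq = trans (cong₂ Rat._*_ eq eq) (solve 1 (λ q → (:- q) :* (:- q) := q :* q) refl q)
    step : ∀ n → δ Rat.≤ ∣ seq x n Rat.- 0ℚ ∣ →
           δ Rat.* δ Rat.≤ ∣ (seq x n Rat.* seq x n Rat.+ seq y n Rat.* seq y n) Rat.- 0ℚ ∣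
    step n δ≤ = subst (δ Rat.* δ Rat.≤_)
      (cong ∣_∣ (sym (ℚₚ.+-identityʳ (p Rat.* p Rat.+ q Rat.* q))))
      (ℚₚ.≤-trans
        (*-mono-≤-nonNeg (ℚₚ.<⇒≤ δ>0) (ℚₚ.0≤∣p∣ p) δ≤∣p∣ δ≤∣p∣)
        (subst₂ Rat._≤_
          (trans (sym (ℚₚ.0≤p⇒∣p∣≡p (square≥0 p))) (ℚₚ.∣p*q∣≡∣p∣*∣q∣ p p))
          (sym (ℚₚ.0≤p⇒∣p∣≡p (ℚₚ.+-mono-≤ (square≥0 p) (square≥0 q))))
          (subst (Rat._≤ p Rat.* p Rat.+ q Rat.* q) (ℚₚ.+-identityʳ (p Rat.* p))
            (ℚₚ.+-monoʳ-≤ (p Rat.* p) (square≥0 q)))))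
      where
      p q : ℚ
      p = seq x n
      q = seq y n
      δ≤∣p∣ : δ Rat.≤ ∣ p ∣
      δ≤∣p∣ = subst (δ Rat.≤_) (cong ∣_∣ (ℚₚ.+-identityʳ p)) δ≤

module Complex where

  open Real using (ℝ; seq; pointwise)
  open import Data.Rational.Solver using (module +-*-Solver)
  open +-*-Solver using (solve; con; _:+_; _:*_; _:-_; :-_; _:=_)

  record ℂ : Set where
    no-eta-equality
    constructor _+i_
    field
      re im : ℝ

  open ℂ public

  infix 4 _≈_ _#_

  record _≈_ (z w : ℂ) : Set where
    constructor mk≈
    field
      re≈ : re z Real.≈ re w
      im≈ : im z Real.≈ im w

  data _#_ (z w : ℂ) : Set where
    re# : re z Real.# re w → z # w
    im# : im z Real.# im w → z # w

  open _≈_ public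

  infixl 6 _+_ _-_
  infixl 7 _*_
  infix  8 -_

  fromℝ : ℝ → ℂ
  fromℝ x .re = x
  fromℝ x .im = Real.0#

  fromℚ : ℚ → ℂ
  fromℚ q = fromℝ (Real.fromℚ q)

  0# 1# i : ℂ
  0# = fromℚ 0ℚ
  1# = fromℚ 1ℚ
  i .re = Real.0#
  i .im = Real.1#

  _+_ : ℂ → ℂ → ℂ
  (z + w) .re = re z Real.+ re w
  (z + w) .im = im z Real.+ im w

  -_ : ℂ → ℂ
  (- z) .re = Real.- re z
  (- z) .im = Real.- im z

  _-_ : ℂ → ℂ → ℂ
  z - w = z + (- w)

  _*_ : ℂ → ℂ → ℂ
  (z * w) .re = re z Real.* re w Real.- im z Real.* im w
  (z * w) .im = re z Real.* im w Real.+ im z Real.* re w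

  private
    norm² : ℂ → ℝ
    norm² z = re z Real.* re z Real.+ im z Real.* im z

    norm²#0 : ∀ {z} → z # 0# → norm² z Real.# Real.0#
    norm²#0 (re# a) = Real.squares#0 a
    norm²#0 {z} (im# b) = Real.#-respˡ
      (pointwise λ n → ℚₚ.+-comm (seq (im z) n Rat.* seq (im z) n) (seq (re z) n Rat.* seq (re z) n))
      (Real.squares#0 {im z} {re z} b)

  inv : (z : ℂ) → z # 0# → ℂ
  inv z z#0 .re = re z Real.* Real.inv (norm² z) (norm²#0 z#0)
  inv z z#0 .im = (Real.- im z) Real.* Real.inv (norm² z) (norm²#0 z#0)

  *-cong : ∀ {x y u v} → x ≈ y → u ≈ v → x * u ≈ y * v
  *-cong (mk≈ a b) (mk≈ c d) .re≈ = Real.+-cong (Real.*-cong a c) (Real.-‿cong (Real.*-cong b d))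
  *-cong (mk≈ a b) (mk≈ c d) .im≈ = Real.+-cong (Real.*-cong a d) (Real.*-cong b c)

  *-assoc : ∀ x y z → (x * y) * z ≈ x * (y * z)
  *-assoc x y z .re≈ = pointwise λ n → solve 6
    (λ a b c d e f → (a :* c :- b :* d) :* e :- (a :* d :+ b :* c) :* f
                  := a :* (c :* e :- d :* f) :- b :* (c :* f :+ d :* e)) refl
    (seq (re x) n) (seq (im x) n) (seq (re y) n) (seq (im y) n) (seq (re z) n) (seq (im z) n)
  *-assoc x y z .im≈ = pointwise λ n → solve 6
    (λ a b c d e f → (a :* c :- b :* d) :* f :+ (a :* d :+ b :* c) :* e
                  := a :* (c :* f :+ d :* e) :+ b :* (c :* e :- d :* f)) refl
    (seq (re x) n) (seq (im x) n) (seq (re y) n) (seq (im y) n) (seq (re z) n) (seq (im z) n)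

  *-comm : ∀ x y → x * y ≈ y * x
  *-comm x y .re≈ = pointwise λ n → solve 4
    (λ a b c d → a :* c :- b :* d := c :* a :- d :* b) refl
    (seq (re x) n) (seq (im x) n) (seq (re y) n) (seq (im y) n)
  *-comm x y .im≈ = pointwise λ n → solve 4
    (λ a b c d → a :* d :+ b :* c := c :* b :+ d :* a) refl
    (seq (re x) n) (seq (im x) n) (seq (re y) n) (seq (im y) n)

  *-identityˡ : ∀ x → 1# * x ≈ x
  *-identityˡ x .re≈ = pointwise λ n → solve 2
    (λ a b → con 1ℚ :* a :- con 0ℚ :* b := a) refl (seq (re x) n) (seq (im x) n)
  *-identityˡ x .im≈ = pointwise λ n → solve 2
    (λ a b → con 1ℚ :* b :+ con 0ℚ :* a := b) refl (seq (re x) n) (seq (im x) n)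

  *-distribˡ-+ : ∀ x y z → x * (y + z) ≈ x * y + x * z
  *-distribˡ-+ x y z .re≈ = pointwise λ n → solve 6
    (λ a b c d e f → a :* (c :+ e) :- b :* (d :+ f) := (a :* c :- b :* d) :+ (a :* e :- b :* f)) refl
    (seq (re x) n) (seq (im x) n) (seq (re y) n) (seq (im y) n) (seq (re z) n) (seq (im z) n)
  *-distribˡ-+ x y z .im≈ = pointwise λ n → solve 6
    (λ a b c d e f → a :* (d :+ f) :+ b :* (c :+ e) := (a :* d :+ b :* c) :+ (a :* f :+ b :* e)) refl
    (seq (re x) n) (seq (im x) n) (seq (re y) n) (seq (im y) n) (seq (re z) n) (seq (im z) n)

  private
    module R = CommutativeRing Real.commutativeRing

  +-cong : ∀ {x y u v} → x ≈ y → u ≈ v → x + u ≈ y + v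
  +-cong (mk≈ a b) (mk≈ c d) .re≈ = R.+-cong a c
  +-cong (mk≈ a b) (mk≈ c d) .im≈ = R.+-cong b d

  +-comm : ∀ x y → x + y ≈ y + x
  +-comm x y .re≈ = R.+-comm (re x) (re y)
  +-comm x y .im≈ = R.+-comm (im x) (im y)

  ≈-refl : ∀ {x} → x ≈ x
  ≈-refl = mk≈ R.refl R.refl

  ≈-sym : ∀ {x y} → x ≈ y → y ≈ x
  ≈-sym (mk≈ a b) = mk≈ (R.sym a) (R.sym b)

  ≈-trans : ∀ {x y z} → x ≈ y → y ≈ z → x ≈ z
  ≈-trans (mk≈ a b) (mk≈ c d) = mk≈ (R.trans a c) (R.trans b d)

  commutativeRing : CommutativeRing 0ℓ 0ℓ
  commutativeRing = record
    { Carrier = ℂ ; _≈_ = _≈_ ; _+_ = _+_ ; _*_ = _*_ ; -_ = -_ ; 0# = 0# ; 1# = 1#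
    ; isCommutativeRing = record
      { isRing = record
        { +-isAbelianGroup = record
          { isGroup = record
            { isMonoid = record
              { isSemigroup = record
                { isMagma = record
                  { isEquivalence = record { refl = ≈-refl ; sym = ≈-sym ; trans = ≈-trans }
                  ; ∙-cong = +-cong }
                ; assoc = λ x y z → mk≈ (R.+-assoc _ _ _) (R.+-assoc _ _ _) }
              ; identity = (λ x → mk≈ (R.+-identityˡ _) (R.+-identityˡ _))
                         , (λ x → mk≈ (R.+-identityʳ _) (R.+-identityʳ _)) }
            ; inverse = (λ x → mk≈ (R.-‿inverseˡ _) (R.-‿inverseˡ _))
                      , (λ x → mk≈ (R.-‿inverseʳ _) (R.-‿inverseʳ _))
            ; ⁻¹-cong = λ (mk≈ a b) → mk≈ (R.-‿cong a) (R.-‿cong b) }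
          ; comm = +-comm }
        ; *-cong = *-cong
        ; *-assoc = *-assoc
        ; *-identity = *-identityˡ , λ x → ≈-trans (*-comm x 1#) (*-identityˡ x)
        ; distrib = *-distribˡ-+ , λ x y z → ≈-trans (*-comm (y + z) x)
                      (≈-trans (*-distribˡ-+ x y z) (+-cong (*-comm x y) (*-comm x z))) }
      ; *-comm = *-comm } }

  inv-inverseʳ : ∀ z (z#0 : z # 0#) → z * inv z z#0 ≈ 1#
  inv-inverseʳ z z#0 .re≈ = R.trans
    (pointwise λ n → solve 3
      (λ a b r → a :* (a :* r) :- b :* ((:- b) :* r) := (a :* a :+ b :* b) :* r) refl
      (seq (re z) n) (seq (im z) n) (seq (Real.inv (norm² z) (norm²#0 z#0)) n))
    (Real.inv-inverseʳ (norm² z) (norm²#0 z#0))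
  inv-inverseʳ z z#0 .im≈ = pointwise λ n → solve 3
    (λ a b r → a :* ((:- b) :* r) :+ b :* (a :* r) := con 0ℚ) refl
    (seq (re z) n) (seq (im z) n) (seq (Real.inv (norm² z) (norm²#0 z#0)) n)

  inv-inverseˡ : ∀ z (z#0 : z # 0#) → inv z z#0 * z ≈ 1#
  inv-inverseˡ z z#0 = ≈-trans (*-comm (inv z z#0) z) (inv-inverseʳ z z#0)

  #⇒-#0 : ∀ {z w} → z # w → z - w # 0#
  #⇒-#0 (re# a) = re# (Real.#⇒-#0 a)
  #⇒-#0 (im# b) = im# (Real.#⇒-#0 b)

  private
    unit⇒# : ∀ {w} z v → v * (z - w) ≈ 1# → z # w
    unit⇒# z v vz≈1 = Sum.[ (λ a → re# (Real.-#0⇒# (Real.*#0 {x = re v} a)))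
                          , (λ b → im# (Real.-#0⇒# (Real.*#0 {x = im v} (Real.-‿#0 b)))) ]
      (Real.+#0 (Real.#-respˡ (R.sym (re≈ vz≈1)) Real.1#0))

    cotrans : ∀ {x y} → x # y → ∀ z → x # z ⊎ z # y
    cotrans (re# a) z = Sum.map re# re# (Real.#-cotrans a (re z))
    cotrans (im# b) z = Sum.map im# im# (Real.#-cotrans b (im z))

    symm : ∀ {x y} → x # y → y # x
    symm (re# a) = re# (Real.#-sym a)
    symm (im# b) = im# (Real.#-sym b)

    irrefl : ∀ {x y} → x ≈ y → ¬ x # y
    irrefl x≈y (re# a) = Real.#-irrefl (re≈ x≈y) a
    irrefl x≈y (im# b) = Real.#-irrefl (im≈ x≈y) b

  heytingField : HeytingField 0ℓ 0ℓ 0ℓ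
  heytingField = record
    { Carrier = ℂ ; _≈_ = _≈_ ; _#_ = _#_ ; _+_ = _+_ ; _*_ = _*_ ; -_ = -_ ; 0# = 0# ; 1# = 1#
    ; isHeytingField = record
      { isHeytingCommutativeRing = record
        { isCommutativeRing = CommutativeRing.isCommutativeRing commutativeRing
        ; isApartnessRelation = record { irrefl = irrefl ; sym = symm ; cotrans = cotrans }
        ; #⇒invertible = λ z#w → let z-w#0 = #⇒-#0 z#w in
            inv _ z-w#0 , inv-inverseˡ _ z-w#0 , inv-inverseʳ _ z-w#0
        ; invertible⇒# = λ {z} (v , vz≈1 , _) → unit⇒# z v vz≈1 }
      ; tight = λ z w → (λ ¬z#w → mk≈ (Real.#-tight _ _ λ a → ¬z#w (re# a))
                                      (Real.#-tight _ _ λ b → ¬z#w (im# b)))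
                      , irrefl } }

open Real public using (ℝ)
open Complex public using (ℂ; fromℝ; fromℚ; i; 0#; 1#; _+_; _-_; -_; _*_; _≈_; _#_; inv)

open import Algebra.Properties.CommutativeMonoid.Sum (CommutativeRing.+-commutativeMonoid Complex.commutativeRing) using (sum)

∑< ∑≤ : ℕ → (ℕ → ℂ) → ℂ
∑< n f = sum {n} (λ l → f (toℕ l))
∑≤ n f = ∑< (suc n) f

infixl 10 ∑< ∑≤
syntax ∑< n (λ l → z) = ∑[ l < n ] z
syntax ∑≤ n (λ l → z) = ∑[ l ≤ n ] z

fromℕ : ℕ → ℂ
fromℕ n = fromℚ (+ n Rat./ 1)

1/_! : ℕ → ℚ
1/ n ! = (+ 1 Rat./ n !) {{n !≢0}}

infixr 8 _^ℤ_

_^ℤ_ : (n : ℕ) .{{_ : ℕ.NonZero n}} → ℤ → ℚ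
n ^ℤ (+ k)    = + (n ℕ.^ k) Rat./ 1
n ^ℤ -[1+ k ] = (+ 1 Rat./ (n ℕ.^ suc k)) {{ℕₚ.m^n≢0 n (suc k)}}

^ℤ-positive : ∀ n .{{_ : ℕ.NonZero n}} k → Rat.Positive (n ^ℤ k)
^ℤ-positive n (+ k)    = ℚₚ.normalize-pos (n ℕ.^ k) 1 {{_}} {{ℕₚ.m^n≢0 n k}}
^ℤ-positive n -[1+ k ] = ℚₚ.normalize-pos 1 (n ℕ.^ suc k) {{ℕₚ.m^n≢0 n (suc k)}}

1/[_^_] : (n : ℕ) .{{_ : ℕ.NonZero n}} → ℤ → ℚ
1/[ n ^ k ] = (Rat.1/ (n ^ℤ k)) {{ℚₚ.pos⇒nonZero (n ^ℤ k) {{^ℤ-positive n k}}}}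

-- f stands for the formal power series ∑ₙ f n tⁿ
PowerSeries : Set
PowerSeries = ℕ → ℂ

infixl 6 _⊕_ _⊖_
infixl 7 _⊛_ _·_
infixr 8 _^_

const : ℂ → PowerSeries
const z zero    = z
const z (suc _) = 0#

_⊕_ _⊖_ _⊛_ : PowerSeries → PowerSeries → PowerSeries
(f ⊕ g) n = f n + g n
(f ⊖ g) n = f n - g n
(f ⊛ g) n = ∑[ l ≤ n ] (f l * g (n ∸ l))

_·_ : ℂ → PowerSeries → PowerSeries
(z · f) n = z * f n

_^_ : PowerSeries → ℕ → PowerSeries
f ^ zero  = const 1#
f ^ suc j = f ⊛ f ^ j

-- f(g(t)) when g has constant term 0, in which case g ^ j does not contribute to
-- the coefficient of tⁿ for j > n
_∘ₚ_ : PowerSeries → PowerSeries → PowerSeries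
(f ∘ₚ g) n = ∑[ j ≤ n ] (f j * (g ^ j) n)

-- coefficients n, n-1, …, 0 of 1/f, from
-- f₀ g₀ = 1  and  f₀ gₙ₊₁ = - (f₁ gₙ + f₂ gₙ₋₁ + ⋯ + fₙ₊₁ g₀)
inverse-prefix : (f : PowerSeries) → f 0 # 0# → (n : ℕ) → Vec ℂ (suc n)
inverse-prefix f f₀#0 zero    = inv (f 0) f₀#0 ∷ []
inverse-prefix f f₀#0 (suc n) =
  - (inv (f 0) f₀#0 * sum (λ l → f (suc (toℕ l)) * lookup prefix l)) ∷ prefix
  where
  prefix : Vec ℂ (suc n)
  prefix = inverse-prefix f f₀#0 n

inverse : (f : PowerSeries) → f 0 # 0# → PowerSeries
inverse f f₀#0 n = head (inverse-prefix f f₀#0 n)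

-- ∑ₙ a n tⁿ/n!
egf : (ℕ → ℂ) → PowerSeries
egf a n = a n * fromℚ (1/ n !)

-- the sequence a with f = egf a
egf-coeff : PowerSeries → ℕ → ℂ
egf-coeff f n = fromℕ (n !) * f n

-- (z)ₙ,λ = z (z - λ) ⋯ (z - (n - 1) λ)
falling : ℝ → ℂ → ℕ → ℂ
falling lam z zero    = 1#
falling lam z (suc n) = falling lam z n * (z - fromℕ n * fromℝ lam)

-- e_λ^z(t)
degExp : ℝ → ℂ → PowerSeries
degExp lam z = egf (falling lam z)

-- (1 + t)^λ, with coefficients the generalised binomials λ (λ - 1) ⋯ (λ - n + 1) / n!
binomialSeries : ℝ → PowerSeries
binomialSeries lam = egf (falling Real.1# (fromℝ lam))

-- log_λ(1 + t)
degLog : (lam : ℝ) → lam Real.# Real.0# → PowerSeries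
degLog lam lam#0 = inv (fromℝ lam) (Complex.re# lam#0) · (binomialSeries lam ⊖ const 1#)

S₁ : (lam : ℝ) → lam Real.# Real.0# → ℕ → ℕ → ℂ
S₁ lam lam#0 n j = egf-coeff (fromℚ (1/ j !) · degLog lam lam#0 ^ j) n

Ei : ℤ → ℝ → PowerSeries
Ei k lam zero    = 0#
Ei k lam (suc n) = falling lam 1# (suc n) * fromℚ (1/[ suc n ^ k ] Rat.* 1/ n !)

2i#0 : fromℕ 2 * i # 0#
2i#0 = Complex.im# (Real.mk# (+ 2 Rat./ 1) (ℚₚ.positive⁻¹ (+ 2 Rat./ 1)) (0 , λ _ _ → ℚₚ.≤-refl))

degCos degSin : ℝ → ℝ → PowerSeries
degCos lam y = fromℚ ½ · (degExp lam (i * fromℝ y) ⊕ degExp lam (- (i * fromℝ y)))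
degSin lam y = inv (fromℕ 2 * i) 2i#0 · (degExp lam (i * fromℝ y) ⊖ degExp lam (- (i * fromℝ y)))

e-u : ℝ → ℂ → PowerSeries
e-u lam u = degExp lam 1# ⊖ const u

e-u#0 : ∀ lam u → u # 1# → e-u lam u 0 # 0#
e-u#0 lam u u#1 = #-congʳ (Complex.+-cong (Complex.≈-sym (Complex.*-identityˡ 1#)) Complex.≈-refl)
                          (Complex.#⇒-#0 (#-sym u#1))
  where
  open HeytingField Complex.heytingField using (#-sym; heytingCommutativeRing)
  open import Algebra.Apartness.Properties.HeytingCommutativeRing heytingCommutativeRing using (#-congʳ)

polyFrobeniusGenocchi : (lam : ℝ) → lam Real.# Real.0# → ℤ → (u : ℂ) → u # 1# → PowerSeries
polyFrobeniusGenocchi lam lam#0 k u u#1 =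
  ((1# - u) · (Ei k lam ∘ₚ degLog lam lam#0)) ⊛ inverse (e-u lam u) (e-u#0 lam u u#1)

FGᶜ FGˢ : (lam : ℝ) → lam Real.# Real.0# → ℤ → (u : ℂ) → u # 1# → (x y : ℝ) → ℕ → ℂ
FGᶜ lam lam#0 k u u#1 x y =
  egf-coeff (polyFrobeniusGenocchi lam lam#0 k u u#1 ⊛ degExp lam (fromℝ x) ⊛ degCos lam y)
FGˢ lam lam#0 k u u#1 x y =
  egf-coeff (polyFrobeniusGenocchi lam lam#0 k u u#1 ⊛ degExp lam (fromℝ x) ⊛ degSin lam y)

{-# OPTIONS --safe #-}

-- Write T for the degenerate cosine or sine and E for e_λ^x.  Multiplying the
-- generating function of FG by e_λ - u cancels the denominator and leaves
-- (1 - u) Ei_k(log_λ(1 + t)) E T.  Both sides of the identity are n! times the n-th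
-- coefficient of this product, up to the factor 2 or 2i: the left by the binomial
-- convolution formula for exponential generating functions, the right by the same
-- formula, because Ei_k(log_λ(1 + t)) has no constant term and its exponential
-- coefficients are ∑ⱼ (1)ⱼ,λ j^(1-k) S₁,λ(m, j).
module Submission where

open import Defs
open import Algebra.Bundles using (CommutativeMonoid; CommutativeRing)
import Algebra.Solver.CommutativeMonoid
open import Data.Fin.Base using (Fin; zero; suc; toℕ)
open import Data.Fin.Properties using (toℕ<n)
open import Data.Integer.Base as ℤ using (ℤ; +_; -[1+_]; 1ℤ) renaming (_-_ to _-ℤ_)
import Data.Integer.Properties as ℤₚ
open import Data.Nat.Base as ℕ using (ℕ; zero; suc; _∸_; _!; _≤_; s≤s; s≤s⁻¹)
open import Data.Nat.Combinatorics using (_C_; nCk≡n!/k![n-k]!; k![n∸k]!∣n!)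
import Data.Nat.DivMod as ℕ
open import Data.Nat.Properties as ℕₚ using (_!≢0; _!*_!≢0)
open import Data.Nat.Tactic.RingSolver using (solve-∀)
open import Data.Product.Base using (_×_; _,_)
open import Data.Rational.Base as ℚ using (ℚ; 1ℚ; ½; _/_)
import Data.Rational.Properties as ℚₚ
import Data.Rational.Solver
import Data.Rational.Unnormalised.Base as ℚᵘ
import Data.Rational.Unnormalised.Properties as ℚᵘₚ
open import Data.Vec.Base using (lookup)
open import Function.Base using (_∘_)
open import Level using (0ℓ)
open import Relation.Binary.PropositionalEquality as ≡ using (_≡_)

-- Rational numbers

-- Once the denominators are matched as successors, `/` is by definition `fromℚᵘ` of an unnormalised
-- fraction, whose equality is cross-multiplication; no gcd has to be computed.
/-cross : ∀ a b c d .{{_ : ℕ.NonZero b}} .{{_ : ℕ.NonZero d}} →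
          a ℕ.* d ≡ c ℕ.* b → + a / b ≡ + c / d
/-cross a (suc b) c (suc d) eq = ℚₚ.fromℚᵘ-cong {ℚᵘ.mkℚᵘ (+ a) b} {ℚᵘ.mkℚᵘ (+ c) d}
  (ℚᵘ.*≡* (≡.trans (≡.sym (ℤₚ.pos-* a (suc d))) (≡.trans (≡.cong +_ eq) (ℤₚ.pos-* c (suc b)))))

/-* : ∀ a b c d .{{_ : ℕ.NonZero b}} .{{_ : ℕ.NonZero d}} .{{_ : ℕ.NonZero (b ℕ.* d)}} →
      (+ a / b) ℚ.* (+ c / d) ≡ + (a ℕ.* c) / (b ℕ.* d)
/-* a (suc b) c (suc d) = ℚₚ.toℚᵘ-injective
  (ℚᵘₚ.≃-trans (ℚₚ.toℚᵘ-homo-* (+ a / suc b) (+ c / suc d))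
  (ℚᵘₚ.≃-trans (ℚᵘₚ.*-cong (ℚₚ.toℚᵘ-fromℚᵘ (ℚᵘ.mkℚᵘ (+ a) b)) (ℚₚ.toℚᵘ-fromℚᵘ (ℚᵘ.mkℚᵘ (+ c) d)))
  (ℚᵘₚ.≃-trans (ℚᵘ.*≡* (≡.cong (ℤ._* + (suc b ℕ.* suc d)) (≡.sym (ℤₚ.pos-* a c))))
               (ℚᵘₚ.≃-sym (ℚₚ.toℚᵘ-fromℚᵘ (ℚᵘ.mkℚᵘ (+ (a ℕ.* c)) (d ℕ.+ b ℕ.* suc d)))))))

-- Turns an identity between fractions into one between natural numbers, within reach of the ring
-- solver.
/-*-cross : ∀ a b c d e f .{{_ : ℕ.NonZero b}} .{{_ : ℕ.NonZero d}} .{{_ : ℕ.NonZero f}} →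
            (a ℕ.* c) ℕ.* f ≡ e ℕ.* (b ℕ.* d) → (+ a / b) ℚ.* (+ c / d) ≡ + e / f
/-*-cross a b c d e f eq = ≡.trans (/-* a b c d) (/-cross (a ℕ.* c) (b ℕ.* d) e f eq)
  where instance
    bd≢0 : ℕ.NonZero (b ℕ.* d)
    bd≢0 = ℕₚ.m*n≢0 b d

/1-* : ∀ a b → + (a ℕ.* b) / 1 ≡ (+ a / 1) ℚ.* (+ b / 1)
/1-* a b = ≡.sym (/-* a 1 b 1)

n!*1/n! : ∀ n → (+ (n !) / 1) ℚ.* 1/ n ! ≡ 1ℚ
n!*1/n! n = /-*-cross (n !) 1 1 (n !) 1 1 {{_}} {{n !≢0}} (lemma (n !))
  where
  lemma : ∀ a → (a ℕ.* 1) ℕ.* 1 ≡ 1 ℕ.* (1 ℕ.* a)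
  lemma = solve-∀

1/!-suc : ∀ n → (+ suc n / 1) ℚ.* 1/ suc n ! ≡ 1/ n !
1/!-suc n = /-*-cross (suc n) 1 1 (suc n !) 1 (n !) {{_}} {{suc n !≢0}} {{n !≢0}} (lemma (suc n) (n !))
  where
  lemma : ∀ a b → (a ℕ.* 1) ℕ.* b ≡ 1 ℕ.* (1 ℕ.* (a ℕ.* b))
  lemma = solve-∀

^ℤ-pred : ∀ n .{{_ : ℕ.NonZero n}} k → (+ n / 1) ℚ.* n ^ℤ (k -ℤ 1ℤ) ≡ n ^ℤ k
^ℤ-pred n (+ zero) = /-*-cross n 1 1 (n ℕ.^ 1) 1 1 {{_}} {{ℕₚ.m^n≢0 n 1}} (lemma n)
  where
  lemma : ∀ a → (a ℕ.* 1) ℕ.* 1 ≡ 1 ℕ.* (1 ℕ.* (a ℕ.* 1))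
  lemma = solve-∀
^ℤ-pred n (+ suc k) = ≡.sym (/1-* n (n ℕ.^ k))
-- Here `k -ℤ 1ℤ` computes to `-[1+ suc (k + 0) ]`; the rewrite removes the `+ 0`.
^ℤ-pred n -[1+ k ] rewrite ℕₚ.+-identityʳ k =
  /-*-cross n 1 1 (n ℕ.^ suc (suc k)) 1 (n ℕ.^ suc k)
    {{_}} {{ℕₚ.m^n≢0 n (suc (suc k))}} {{ℕₚ.m^n≢0 n (suc k)}} (lemma n (n ℕ.^ suc k))
  where
  lemma : ∀ a b → (a ℕ.* 1) ℕ.* b ≡ 1 ℕ.* (1 ℕ.* (a ℕ.* b))
  lemma = solve-∀

1/^ℤ-inverse : ∀ n .{{_ : ℕ.NonZero n}} k → n ^ℤ k ℚ.* 1/[ n ^ k ] ≡ 1ℚ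
1/^ℤ-inverse n k = ℚₚ.*-inverseʳ (n ^ℤ k) {{ℚₚ.pos⇒nonZero (n ^ℤ k) {{^ℤ-positive n k}}}}

-- Insert `1 = n^k * s`, write `n^k` as `n * n^(k-1)`, and cancel `n^(k-1)` against `r`.
1/^ℤ-pred : ∀ n .{{_ : ℕ.NonZero n}} k → 1/[ n ^ k -ℤ 1ℤ ] ≡ (+ n / 1) ℚ.* 1/[ n ^ k ]
1/^ℤ-pred n k =
  ≡.trans (≡.sym (ℚₚ.*-identityʳ r))
  (≡.trans (≡.cong (r ℚ.*_) (≡.sym (1/^ℤ-inverse n k)))
  (≡.trans (≡.cong (λ p → r ℚ.* (p ℚ.* s)) (≡.sym (^ℤ-pred n k)))
  (≡.trans (rearrange r (+ n / 1) (n ^ℤ (k -ℤ 1ℤ)) s)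
  (≡.trans (≡.cong (ℚ._* ((+ n / 1) ℚ.* s)) (1/^ℤ-inverse n (k -ℤ 1ℤ)))
           (ℚₚ.*-identityˡ _)))))
  where
  r s : ℚ
  r = 1/[ n ^ k -ℤ 1ℤ ]
  s = 1/[ n ^ k ]
  open Data.Rational.Solver.+-*-Solver using (solve; _:*_; _:=_)
  rearrange : ∀ r a q s → r ℚ.* ((a ℚ.* q) ℚ.* s) ≡ (q ℚ.* r) ℚ.* (a ℚ.* s)
  rearrange = solve 4 (λ r a q s → r :* ((a :* q) :* s) := (q :* r) :* (a :* s)) ≡.refl

-- Trades a factor `suc j` between power and factorial: the coefficients of `Ei` carry `1/ j !`,
-- while `S₁` absorbs `1/ suc j !`. This is the source of the exponent `k - 1`.
1/^ℤ*1/! : ∀ j k → 1/[ suc j ^ k ] ℚ.* 1/ j ! ≡ 1/[ suc j ^ k -ℤ 1ℤ ] ℚ.* 1/ suc j !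
1/^ℤ*1/! j k =
  ≡.trans (≡.cong (s ℚ.*_) (≡.sym (1/!-suc j)))
  (≡.trans (rearrange s (+ suc j / 1) (1/ suc j !))
           (≡.cong (ℚ._* 1/ suc j !) (≡.sym (1/^ℤ-pred (suc j) k))))
  where
  s : ℚ
  s = 1/[ suc j ^ k ]
  open Data.Rational.Solver.+-*-Solver using (solve; _:*_; _:=_)
  rearrange : ∀ s a b → s ℚ.* (a ℚ.* b) ≡ (a ℚ.* s) ℚ.* b
  rearrange = solve 3 (λ s a b → s :* (a :* b) := (a :* s) :* b) ≡.refl

-- Binomial coefficients

nCk*k![n∸k]!≡n! : ∀ {n k} → k ≤ n → (n C k) ℕ.* (k ! ℕ.* (n ∸ k) !) ≡ n !
nCk*k![n∸k]!≡n! {n} {k} k≤n =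
  ≡.trans (≡.cong (ℕ._* (k ! ℕ.* (n ∸ k) !)) (nCk≡n!/k![n-k]! k≤n))
          (ℕ.m/n*n≡m {{k !* (n ∸ k) !≢0}} (k![n∸k]!∣n! k≤n))

-- Multiplied by `k ! * (n ∸ k) !`, both sides become `suc n !`.
[1+n]C[1+k]*[1+k]≡[1+n]*nCk : ∀ {n k} → k ≤ n → (suc n C suc k) ℕ.* suc k ≡ suc n ℕ.* (n C k)
[1+n]C[1+k]*[1+k]≡[1+n]*nCk {n} {k} k≤n =
  ℕₚ.*-cancelʳ-≡ _ _ (k ! ℕ.* (n ∸ k) !) {{k !* (n ∸ k) !≢0}}
    (≡.trans (lemma (suc n C suc k) (suc k) (k !) ((n ∸ k) !))
    (≡.trans (nCk*k![n∸k]!≡n! (s≤s k≤n))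
    (≡.trans (≡.cong (suc n ℕ.*_) (≡.sym (nCk*k![n∸k]!≡n! k≤n)))
             (≡.sym (ℕₚ.*-assoc (suc n) (n C k) _)))))
  where
  lemma : ∀ c a b d → (c ℕ.* a) ℕ.* (b ℕ.* d) ≡ c ℕ.* ((a ℕ.* b) ℕ.* d)
  lemma = solve-∀

[1+n]C[1+k]/1 : ∀ {n k} → k ≤ n → + (suc n C suc k) / 1 ≡ (+ suc n / 1) ℚ.* (+ (n C k) / suc k)
[1+n]C[1+k]/1 {n} {k} k≤n = ≡.sym (/-*-cross (suc n) 1 (n C k) (suc k) (suc n C suc k) 1
  (≡.trans (ℕₚ.*-identityʳ _)
  (≡.trans (≡.sym ([1+n]C[1+k]*[1+k]≡[1+n]*nCk k≤n))
           (≡.cong ((suc n C suc k) ℕ.*_) (≡.sym (ℕₚ.*-identityˡ (suc k)))))))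

open CommutativeRing Complex.commutativeRing
  using (setoid; refl; sym; trans; reflexive; +-cong; +-congˡ; +-congʳ; *-cong; *-congˡ; *-congʳ;
         +-identityˡ; +-identityʳ; *-identityˡ; *-comm; *-assoc; zeroˡ; zeroʳ; distribˡ;
         distribʳ; -‿inverseˡ; +-assoc; -‿cong; commutativeSemiring; semiring; ring)
open import Algebra.Properties.Semiring.Sum semiring
  using (sum; sum-cong-≋; sum-replicate-zero; ∑-distrib-+; *-distribˡ-sum)
open import Algebra.Properties.Ring ring using (-‿distribˡ-*; -‿distribʳ-*; -0#≈0#)
open import Algebra.Solver.Ring.NaturalCoefficients.Default commutativeSemiring
  using (solve; _:+_; _:*_; _:=_)
open import Relation.Binary.Reasoning.Setoid setoid

-- Rational and natural numbers inside ℂ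

fromℚ-* : ∀ p q → fromℚ (p ℚ.* q) ≈ fromℚ p * fromℚ q
fromℚ-* p q = Complex.mk≈
  (Real.pointwise λ _ → ≡.sym (ℚₚ.+-identityʳ (p ℚ.* q)))
  (Real.pointwise λ _ → ≡.sym (≡.cong₂ ℚ._+_ (ℚₚ.*-zeroʳ p) (ℚₚ.*-zeroˡ q)))

fromℕ-* : ∀ m n → fromℕ (m ℕ.* n) ≈ fromℕ m * fromℕ n
fromℕ-* m n = trans (reflexive (≡.cong fromℚ (/1-* m n))) (fromℚ-* (+ m / 1) (+ n / 1))

fromℕ-! : ∀ n → fromℕ (n !) * fromℚ (1/ n !) ≈ 1#
fromℕ-! n = trans (sym (fromℚ-* _ _)) (reflexive (≡.cong fromℚ (n!*1/n! n)))

fromℕ-C : ∀ {n k} → k ≤ n → fromℕ (n !) ≈ fromℕ (n C k) * (fromℕ (k !) * fromℕ ((n ∸ k) !))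
fromℕ-C {n} {k} k≤n = begin
  fromℕ (n !)                                        ≡⟨ ≡.cong fromℕ (nCk*k![n∸k]!≡n! k≤n) ⟨
  fromℕ ((n C k) ℕ.* (k ! ℕ.* (n ∸ k) !))              ≈⟨ fromℕ-* (n C k) (k ! ℕ.* (n ∸ k) !) ⟩
  fromℕ (n C k) * fromℕ (k ! ℕ.* (n ∸ k) !)          ≈⟨ *-congˡ (fromℕ-* (k !) ((n ∸ k) !)) ⟩
  fromℕ (n C k) * (fromℕ (k !) * fromℕ ((n ∸ k) !))  ∎

-- Power series

∑<-cong : ∀ n {f g : ℕ → ℂ} → (∀ l → l ℕ.< n → f l ≈ g l) → ∑< n f ≈ ∑< n g
∑<-cong n f≈g = sum-cong-≋ (λ l → f≈g (toℕ l) (toℕ<n l))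

∑≤-cong : ∀ n {f g : ℕ → ℂ} → (∀ l → l ≤ n → f l ≈ g l) → ∑≤ n f ≈ ∑≤ n g
∑≤-cong n f≈g = ∑<-cong (suc n) (λ l l<1+n → f≈g l (s≤s⁻¹ l<1+n))

infix 4 _≋_

_≋_ : PowerSeries → PowerSeries → Set
f ≋ g = ∀ n → f n ≈ g n

-- The series `(f - f 0) / t`. By definition `(f ⊛ g) (suc n)` unfolds to
-- `f 0 * g (suc n) + (shift f ⊛ g) n`, which drives the inductions on coefficients below.
shift : PowerSeries → PowerSeries
shift f = f ∘ suc

⊛-cong : ∀ {f f′ g g′} → f ≋ f′ → g ≋ g′ → f ⊛ g ≋ f′ ⊛ g′
⊛-cong f≋f′ g≋g′ n = ∑≤-cong n (λ l _ → *-cong (f≋f′ l) (g≋g′ (n ∸ l)))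

⊛-distribʳ-⊕ : ∀ f g h → (f ⊕ g) ⊛ h ≋ f ⊛ h ⊕ g ⊛ h
⊛-distribʳ-⊕ f g h n = trans
  (∑≤-cong n (λ l _ → solve 3 (λ a b c → (a :+ b) :* c := a :* c :+ b :* c) refl (f l) (g l) (h (n ∸ l))))
  (∑-distrib-+ {suc n} (λ l → f (toℕ l) * h (n ∸ toℕ l)) (λ l → g (toℕ l) * h (n ∸ toℕ l)))

·-⊛ : ∀ z f g → (z · f) ⊛ g ≋ z · (f ⊛ g)
·-⊛ z f g n = trans
  (∑≤-cong n (λ l _ → *-assoc z (f l) (g (n ∸ l))))
  (sym (*-distribˡ-sum {suc n} z (λ l → f (toℕ l) * g (n ∸ toℕ l))))

-- Splits off the last term of the convolution, whereas unfolding splits off the first;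
-- commutativity comes from comparing the two.
⊛-suc : ∀ f g n → (f ⊛ g) (suc n) ≈ (f ⊛ shift g) n + f (suc n) * g 0
⊛-suc f g zero    = solve 3 (λ a b o → a :+ (b :+ o) := (a :+ o) :+ b) refl _ _ 0#
⊛-suc f g (suc n) = trans (+-congˡ (⊛-suc (shift f) g n)) (sym (+-assoc _ _ _))

⊛-comm : ∀ f g → f ⊛ g ≋ g ⊛ f
⊛-comm f g zero    = +-congʳ (*-comm (f 0) (g 0))
⊛-comm f g (suc n) = begin
  f 0 * g (suc n) + (shift f ⊛ g) n  ≈⟨ +-congˡ (⊛-comm (shift f) g n) ⟩
  f 0 * g (suc n) + (g ⊛ shift f) n  ≈⟨ solve 3 (λ a b c → a :* b :+ c := c :+ b :* a) refl (f 0) (g (suc n)) _ ⟩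
  (g ⊛ shift f) n + g (suc n) * f 0  ≈⟨ ⊛-suc g f n ⟨
  (g ⊛ f) (suc n)                    ∎

⊛-assoc : ∀ f g h → (f ⊛ g) ⊛ h ≋ f ⊛ (g ⊛ h)
⊛-assoc f g h zero = begin
  (f 0 * g 0 + 0#) * h 0 + 0#  ≈⟨ +-congʳ (*-congʳ (+-identityʳ _)) ⟩
  f 0 * g 0 * h 0 + 0#         ≈⟨ +-congʳ (*-assoc (f 0) (g 0) (h 0)) ⟩
  f 0 * (g 0 * h 0) + 0#       ≈⟨ +-congʳ (*-congˡ (+-identityʳ _)) ⟨
  f 0 * (g 0 * h 0 + 0#) + 0#  ∎
⊛-assoc f g h (suc n) = begin
  -- The product rule for `shift` holds by definition: `shift (f ⊛ g)` is
  -- `f 0 · shift g ⊕ shift f ⊛ g`.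
  (f 0 * g 0 + 0#) * h (suc n) + ((f 0 · shift g ⊕ shift f ⊛ g) ⊛ h) n
    ≈⟨ +-cong (*-congʳ (+-identityʳ _)) (⊛-distribʳ-⊕ (f 0 · shift g) (shift f ⊛ g) h n) ⟩
  f 0 * g 0 * h (suc n) + (((f 0 · shift g) ⊛ h) n + ((shift f ⊛ g) ⊛ h) n)
    ≈⟨ +-congˡ (+-cong (·-⊛ (f 0) (shift g) h n) (⊛-assoc (shift f) g h n)) ⟩
  f 0 * g 0 * h (suc n) + (f 0 * (shift g ⊛ h) n + (shift f ⊛ (g ⊛ h)) n)
    ≈⟨ solve 5 (λ a b c d e → a :* b :* c :+ (a :* d :+ e) := a :* (b :* c :+ d) :+ e) refl
         (f 0) (g 0) (h (suc n)) _ _ ⟩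
  f 0 * (g 0 * h (suc n) + (shift g ⊛ h) n) + (shift f ⊛ (g ⊛ h)) n
    ∎

const-⊛ : ∀ z f → const z ⊛ f ≋ z · f
const-⊛ z f zero    = +-identityʳ _
const-⊛ z f (suc n) = trans
  (+-congˡ (trans (∑≤-cong n (λ l _ → zeroˡ (f (n ∸ l)))) (sum-replicate-zero (suc n))))
  (+-identityʳ _)

⊛-identityˡ : ∀ f → const 1# ⊛ f ≋ f
⊛-identityˡ f n = trans (const-⊛ 1# f n) (*-identityˡ (f n))

-- Packaged for the monoid solver, which later reorders a product of five series.
⊛-commutativeMonoid : CommutativeMonoid 0ℓ 0ℓ
⊛-commutativeMonoid = record
  { Carrier = PowerSeries ; _≈_ = _≋_ ; _∙_ = _⊛_ ; ε = const 1#
  ; isCommutativeMonoid = record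
    { isMonoid = record
      { isSemigroup = record
        { isMagma = record
          { isEquivalence = record
            { refl  = λ _ → refl
            ; sym   = λ f≋g n → sym (f≋g n)
            ; trans = λ f≋g g≋h n → trans (f≋g n) (g≋h n) }
          ; ∙-cong = ⊛-cong }
        ; assoc = ⊛-assoc }
      ; identity = ⊛-identityˡ , λ f n → trans (⊛-comm f (const 1#) n) (⊛-identityˡ f n) }
    ; comm = ⊛-comm } }

-- The prefix lists coefficients in descending order, so the sum in its recursion is a convolution
-- with `inverse f f₀#0`.
lookup-inverse-prefix : ∀ f (f₀#0 : f 0 # 0#) n (l : Fin (suc n)) →
                        lookup (inverse-prefix f f₀#0 n) l ≡ inverse f f₀#0 (n ∸ toℕ l)
lookup-inverse-prefix f f₀#0 zero    zero    = ≡.refl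
lookup-inverse-prefix f f₀#0 (suc n) zero    = ≡.refl
lookup-inverse-prefix f f₀#0 (suc n) (suc l) = lookup-inverse-prefix f f₀#0 n l

⊛-inverse : ∀ f (f₀#0 : f 0 # 0#) → f ⊛ inverse f f₀#0 ≋ const 1#
⊛-inverse f f₀#0 zero    = trans (+-identityʳ _) (Complex.inv-inverseʳ (f 0) f₀#0)
⊛-inverse f f₀#0 (suc n) = begin
  -- The new coefficient is `- (r * s)` by definition, and the remaining convolution equals `s`;
  -- since `f 0 * r ≈ 1#`, the two cancel.
  f 0 * (- (r * s)) + (shift f ⊛ inverse f f₀#0) n
    ≈⟨ +-cong (sym (-‿distribʳ-* (f 0) (r * s)))
              (sum-cong-≋ λ l → *-congˡ {f (suc (toℕ l))} (reflexive (≡.sym (lookup-inverse-prefix f f₀#0 n l)))) ⟩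
  - (f 0 * (r * s)) + s
    ≈⟨ +-congʳ (-‿cong (trans (sym (*-assoc (f 0) r s))
                       (trans (*-congʳ (Complex.inv-inverseʳ (f 0) f₀#0)) (*-identityˡ s)))) ⟩
  - s + s
    ≈⟨ -‿inverseˡ s ⟩
  0# ∎
  where
  r s : ℂ
  r = inv (f 0) f₀#0
  s = sum (λ l → f (suc (toℕ l)) * lookup (inverse-prefix f f₀#0 n) l)

-- Exponential generating functions

egf-coeff-egf : ∀ a n → egf-coeff (egf a) n ≈ a n
egf-coeff-egf a n = begin
  fromℕ (n !) * (a n * fromℚ (1/ n !))
    ≈⟨ solve 3 (λ x y z → x :* (y :* z) := (x :* z) :* y) refl (fromℕ (n !)) (a n) (fromℚ (1/ n !)) ⟩
  (fromℕ (n !) * fromℚ (1/ n !)) * a n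
    ≈⟨ *-congʳ (fromℕ-! n) ⟩
  1# * a n
    ≈⟨ *-identityˡ (a n) ⟩
  a n
    ∎

-- Binomial convolution: `n !` splits as `(n C l) * l ! * (n ∸ l) !`, and each factorial goes to its
-- own series.
egf-coeff-⊛ : ∀ f g n →
  egf-coeff (f ⊛ g) n ≈ ∑[ l ≤ n ] (fromℕ (n C l) * egf-coeff f l * egf-coeff g (n ∸ l))
egf-coeff-⊛ f g n = trans
  (*-distribˡ-sum {suc n} (fromℕ (n !)) (λ l → f (toℕ l) * g (n ∸ toℕ l)))
  (∑≤-cong n λ l l≤n → trans (*-congʳ (fromℕ-C l≤n))
    (solve 5 (λ c a b x y → (c :* (a :* b)) :* (x :* y) := c :* (a :* x) :* (b :* y)) refl
      (fromℕ (n C l)) (fromℕ (l !)) (fromℕ ((n ∸ l) !)) (f l) (g (n ∸ l))))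

egf-coeff-⊛-egf : ∀ f a n →
  egf-coeff (f ⊛ egf a) n ≈ ∑[ l ≤ n ] (fromℕ (n C l) * a (n ∸ l) * egf-coeff f l)
egf-coeff-⊛-egf f a n = trans (egf-coeff-⊛ f (egf a) n) (∑≤-cong n λ l _ →
  trans (*-congˡ (egf-coeff-egf a (n ∸ l)))
        (solve 3 (λ x y z → x :* y :* z := x :* z :* y) refl (fromℕ (n C l)) (egf-coeff f l) (a (n ∸ l))))

egf-coeff-egf-⊛-egf : ∀ a b n →
  egf-coeff (egf a ⊛ egf b) n ≈ ∑[ l ≤ n ] (fromℕ (n C l) * b (n ∸ l) * a l)
egf-coeff-egf-⊛-egf a b n =
  trans (egf-coeff-⊛-egf (egf a) b n) (∑≤-cong n λ l _ →
    *-congˡ {fromℕ (n C l) * b (n ∸ l)} (egf-coeff-egf a l))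

-- The term `l = 0` of the binomial convolution vanishes. Putting `l = suc m` and absorbing `suc m`
-- into the binomial coefficient brings out the factor `n`.
egf-coeff-⊛-zero : ∀ f g → f 0 ≈ 0# → ∀ n →
  egf-coeff (f ⊛ g) n ≈
  fromℕ n * ∑[ m < n ] (fromℚ (+ ((n ∸ 1) C m) / suc m) * egf-coeff f (suc m) * egf-coeff g (n ∸ 1 ∸ m))
-- At `n = 0` the sum is empty, so the truncated `n ∸ 1` is never evaluated in a term.
egf-coeff-⊛-zero f g f₀≈0 zero = begin
  fromℕ 1 * (f 0 * g 0 + 0#)  ≈⟨ *-congˡ (trans (+-identityʳ _) (trans (*-congʳ f₀≈0) (zeroˡ (g 0)))) ⟩
  fromℕ 1 * 0#                ≈⟨ zeroʳ _ ⟩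
  0#                          ≈⟨ zeroʳ (fromℕ 0) ⟨
  fromℕ 0 * 0#                ∎
egf-coeff-⊛-zero f g f₀≈0 (suc n) = begin
  egf-coeff (f ⊛ g) (suc n)
    ≈⟨ egf-coeff-⊛ f g (suc n) ⟩
  fromℕ (suc n C 0) * (fromℕ 1 * f 0) * egf-coeff g (suc n) + _
    ≈⟨ +-congʳ (trans (*-congʳ (trans (*-congˡ (trans (*-congˡ f₀≈0) (zeroʳ _))) (zeroʳ _))) (zeroˡ _)) ⟩
  0# + ∑[ m ≤ n ] (fromℕ (suc n C suc m) * egf-coeff f (suc m) * egf-coeff g (n ∸ m))
    ≈⟨ +-identityˡ _ ⟩
  ∑[ m ≤ n ] (fromℕ (suc n C suc m) * egf-coeff f (suc m) * egf-coeff g (n ∸ m))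
    ≈⟨ ∑≤-cong n (λ m m≤n → trans
         (*-congʳ (*-congʳ (trans (reflexive (≡.cong fromℚ ([1+n]C[1+k]/1 m≤n))) (fromℚ-* _ _))))
         (solve 4 (λ a b c d → a :* b :* c :* d := a :* (b :* c :* d)) refl
           (fromℕ (suc n)) (fromℚ (+ (n C m) / suc m)) (egf-coeff f (suc m)) (egf-coeff g (n ∸ m)))) ⟩
  ∑[ m ≤ n ] (fromℕ (suc n) * (fromℚ (+ (n C m) / suc m) * egf-coeff f (suc m) * egf-coeff g (n ∸ m)))
    ≈⟨ *-distribˡ-sum {suc n} (fromℕ (suc n)) (λ m →
         fromℚ (+ (n C toℕ m) / suc (toℕ m)) * egf-coeff f (suc (toℕ m)) * egf-coeff g (n ∸ toℕ m)) ⟨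
  fromℕ (suc n) * ∑[ m ≤ n ] (fromℚ (+ (n C m) / suc m) * egf-coeff f (suc m) * egf-coeff g (n ∸ m))
    ∎

egf-distrib-+ : ∀ a b → egf a ⊕ egf b ≋ egf (λ n → a n + b n)
egf-distrib-+ a b n = sym (distribʳ (fromℚ (1/ n !)) (a n) (b n))

egf-distrib-- : ∀ a b → egf a ⊖ egf b ≋ egf (λ n → a n - b n)
egf-distrib-- a b n = trans (+-congˡ (-‿distribˡ-* (b n) (fromℚ (1/ n !))))
                            (sym (distribʳ (fromℚ (1/ n !)) (a n) (- b n)))

-- Poly-Frobenius-Genocchi polynomials

⊛-e-u : ∀ lam u f n → (f ⊛ e-u lam u) n ≈ (f ⊛ degExp lam 1#) n - u * f n
⊛-e-u lam u f n = begin
  (f ⊛ e-u lam u) n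
    ≈⟨ ⊛-comm f (e-u lam u) n ⟩
  ((degExp lam 1# ⊖ const u) ⊛ f) n
    ≈⟨ ⊛-cong {g = f} ⊖-const (λ _ → refl) n ⟩
  ((degExp lam 1# ⊕ const (- u)) ⊛ f) n
    ≈⟨ ⊛-distribʳ-⊕ (degExp lam 1#) (const (- u)) f n ⟩
  (degExp lam 1# ⊛ f) n + (const (- u) ⊛ f) n
    ≈⟨ +-cong (⊛-comm (degExp lam 1#) f n) (trans (const-⊛ (- u) f n) (sym (-‿distribˡ-* u (f n)))) ⟩
  (f ⊛ degExp lam 1#) n - u * f n
    ∎
  where
  ⊖-const : degExp lam 1# ⊖ const u ≋ degExp lam 1# ⊕ const (- u)
  ⊖-const zero    = refl
  -- Above degree zero, subtracting `const u` adds `- 0#`, whereas adding `const (- u)` adds `0#`.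
  ⊖-const (suc n) = +-congˡ -0#≈0#

-- Identifies the bracket on the left of the theorem as the effect of clearing the denominator.
egf-coeff-⊛-e-u : ∀ lam u f n → egf-coeff (f ⊛ e-u lam u) n ≈
  ∑[ l ≤ n ] (fromℕ (n C l) * falling lam 1# (n ∸ l) * egf-coeff f l) - u * egf-coeff f n
egf-coeff-⊛-e-u lam u f n = begin
  N * (f ⊛ e-u lam u) n
    ≈⟨ *-congˡ (⊛-e-u lam u f n) ⟩
  N * ((f ⊛ degExp lam 1#) n - u * f n)
    ≈⟨ distribˡ N _ _ ⟩
  N * (f ⊛ degExp lam 1#) n + N * (- (u * f n))
    ≈⟨ +-cong (egf-coeff-⊛-egf f (falling lam 1#) n) (sym (-‿distribʳ-* N (u * f n))) ⟩
  S - N * (u * f n)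
    ≈⟨ +-congˡ (-‿cong (solve 3 (λ a b c → a :* (b :* c) := b :* (a :* c)) refl N u (f n))) ⟩
  S - u * (N * f n)
    ∎
  where
  N S : ℂ
  N = fromℕ (n !)
  S = ∑[ l ≤ n ] (fromℕ (n C l) * falling lam 1# (n ∸ l) * egf-coeff f l)

module _ (lam : ℝ) (lam#0 : lam Real.# Real.0#) (k : ℤ) where

  Ei∘degLog : PowerSeries
  Ei∘degLog = Ei k lam ∘ₚ degLog lam lam#0

  Ei∘degLog-zero : Ei∘degLog 0 ≈ 0#
  Ei∘degLog-zero = trans (+-identityʳ _) (zeroˡ _)

  -- The term `j = 0` of the composition drops out because `Ei` has no constant term. In the others,
  -- `suc m !`, the factor `1/ suc j !` freed by `1/^ℤ*1/!` and the power of the logarithm make up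
  -- `S₁`.
  egf-coeff-Ei∘degLog : ∀ m → egf-coeff Ei∘degLog (suc m) ≈
    ∑[ j ≤ m ] (falling lam 1# (suc j) * fromℚ 1/[ suc j ^ k -ℤ 1ℤ ] * S₁ lam lam#0 (suc m) (suc j))
  egf-coeff-Ei∘degLog m = begin
    N * (0# * (degLog lam lam#0 ^ 0) (suc m) + ∑[ j ≤ m ] (Ei k lam (suc j) * L j))
      ≈⟨ *-congˡ (trans (+-congʳ (zeroˡ _)) (+-identityˡ _)) ⟩
    N * ∑[ j ≤ m ] (Ei k lam (suc j) * L j)
      ≈⟨ *-distribˡ-sum {suc m} N (λ j → Ei k lam (suc (toℕ j)) * L (toℕ j)) ⟩
    ∑[ j ≤ m ] (N * (Ei k lam (suc j) * L j))
      ≈⟨ ∑≤-cong m (λ j _ → term j) ⟩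
    ∑[ j ≤ m ] (falling lam 1# (suc j) * fromℚ 1/[ suc j ^ k -ℤ 1ℤ ] * S₁ lam lam#0 (suc m) (suc j))
      ∎
    where
    N : ℂ
    N = fromℕ (suc m !)
    L : ℕ → ℂ
    L j = (degLog lam lam#0 ^ suc j) (suc m)
    term : ∀ j → N * (Ei k lam (suc j) * L j) ≈
           falling lam 1# (suc j) * fromℚ 1/[ suc j ^ k -ℤ 1ℤ ] * S₁ lam lam#0 (suc m) (suc j)
    term j = trans
      (*-congˡ (*-congʳ (*-congˡ (trans (reflexive (≡.cong fromℚ (1/^ℤ*1/! j k)))
                                        (fromℚ-* 1/[ suc j ^ k -ℤ 1ℤ ] (1/ suc j !))))))
      (solve 5 (λ n a b c l → n :* ((a :* (b :* c)) :* l) := a :* b :* (n :* (c :* l))) refl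
        N (falling lam 1# (suc j)) (fromℚ 1/[ suc j ^ k -ℤ 1ℤ ]) (fromℚ (1/ suc j !)) (L j))

  module _ (u : ℂ) (u#1 : u # 1#) where

    -- With `E` the degenerate exponential and `T` the degenerate cosine or sine, its exponential
    -- coefficients are `FGᶜ` and `FGˢ` by definition.
    FG-series : PowerSeries → PowerSeries → PowerSeries
    FG-series E T = polyFrobeniusGenocchi lam lam#0 k u u#1 ⊛ E ⊛ T

    FG-series-⊛-e-u : ∀ E T → FG-series E T ⊛ e-u lam u ≋ ((1# - u) · Ei∘degLog) ⊛ (T ⊛ E)
    FG-series-⊛-e-u E T n = begin
      (A ⊛ I ⊛ E ⊛ T ⊛ D) n
        -- Besides bringing `D` next to its inverse, this puts `T` before `E`, so that in the final
        -- sum the trigonometric part has index `l` and the part in `x` the complementary index.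
        ≈⟨ ⊛-solve 5 (λ a i e t d → (((a ⊕ₘ i) ⊕ₘ e) ⊕ₘ t) ⊕ₘ d ⊜ (d ⊕ₘ i) ⊕ₘ (a ⊕ₘ (t ⊕ₘ e)))
             (λ _ → refl) A I E T D n ⟩
      ((D ⊛ I) ⊛ (A ⊛ (T ⊛ E))) n
        ≈⟨ ⊛-cong {g = A ⊛ (T ⊛ E)} (⊛-inverse D (e-u#0 lam u u#1)) (λ _ → refl) n ⟩
      (const 1# ⊛ (A ⊛ (T ⊛ E))) n
        ≈⟨ ⊛-identityˡ (A ⊛ (T ⊛ E)) n ⟩
      (A ⊛ (T ⊛ E)) n
        ∎
      where
      open Algebra.Solver.CommutativeMonoid ⊛-commutativeMonoid
        using (_⊜_) renaming (solve to ⊛-solve; _⊕_ to _⊕ₘ_)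
      A D I : PowerSeries
      A = (1# - u) · Ei∘degLog
      D = e-u lam u
      I = inverse D (e-u#0 lam u u#1)

    -- Covers both halves of the theorem: `c` is 2 or 2i, `c⁻¹` the scalar in the definition of
    -- cosine or sine, and `egf a` the sum or difference of the two exponentials. The outer factor
    -- `c` cancels this scalar.
    FG-identity : ∀ c c⁻¹ → c * c⁻¹ ≈ 1# → ∀ b a T → T ≋ c⁻¹ · egf a → ∀ n →
      c * (∑[ l ≤ n ] (fromℕ (n C l) * falling lam 1# (n ∸ l) * egf-coeff (FG-series (egf b) T) l)
           - u * egf-coeff (FG-series (egf b) T) n)
      ≈ (1# - u) * fromℕ n *
        ∑[ m < n ] (fromℚ (+ ((n ∸ 1) C m) / suc m)
          * ∑[ j ≤ m ] (falling lam 1# (suc j) * fromℚ 1/[ suc j ^ k -ℤ 1ℤ ] * S₁ lam lam#0 (suc m) (suc j))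
          * ∑[ l ≤ n ∸ 1 ∸ m ] (fromℕ ((n ∸ 1 ∸ m) C l) * b (n ∸ 1 ∸ m ∸ l) * a l))
    FG-identity c c⁻¹ cc⁻¹≈1 b a T T≋ n = begin
      c * _
        ≈⟨ *-congˡ (egf-coeff-⊛-e-u lam u (FG-series (egf b) T) n) ⟨
      c * (N * (FG-series (egf b) T ⊛ e-u lam u) n)
        ≈⟨ *-congˡ (*-congˡ (FG-series-⊛-e-u (egf b) T n)) ⟩
      c * (N * (((1# - u) · Ei∘degLog) ⊛ (T ⊛ egf b)) n)
        ≈⟨ *-congˡ (*-congˡ pull-scalars) ⟩
      c * (N * ((1# - u) * (c⁻¹ * P)))
        ≈⟨ solve 5 (λ c N v d P → c :* (N :* (v :* (d :* P))) := (c :* d) :* (v :* (N :* P))) refl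
             c N (1# - u) c⁻¹ P ⟩
      (c * c⁻¹) * ((1# - u) * (N * P))
        ≈⟨ trans (*-congʳ cc⁻¹≈1) (*-identityˡ _) ⟩
      (1# - u) * (N * P)
        ≈⟨ *-congˡ (egf-coeff-⊛-zero Ei∘degLog (egf a ⊛ egf b) Ei∘degLog-zero n) ⟩
      (1# - u) * (fromℕ n * _)
        ≈⟨ *-assoc (1# - u) (fromℕ n) _ ⟨
      (1# - u) * fromℕ n * _
        ≈⟨ *-congˡ (∑<-cong n λ m _ → *-cong
             (*-congˡ {fromℚ (+ ((n ∸ 1) C m) / suc m)} (egf-coeff-Ei∘degLog m))
             (egf-coeff-egf-⊛-egf a b (n ∸ 1 ∸ m))) ⟩
      _ ∎
      where
      N P : ℂ
      N = fromℕ (n !)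
      P = (Ei∘degLog ⊛ (egf a ⊛ egf b)) n
      pull-scalars : (((1# - u) · Ei∘degLog) ⊛ (T ⊛ egf b)) n ≈ (1# - u) * (c⁻¹ * P)
      pull-scalars = begin
        (((1# - u) · Ei∘degLog) ⊛ (T ⊛ egf b)) n
          ≈⟨ ·-⊛ (1# - u) Ei∘degLog (T ⊛ egf b) n ⟩
        (1# - u) * (Ei∘degLog ⊛ (T ⊛ egf b)) n
          ≈⟨ *-congˡ (⊛-cong {Ei∘degLog} (λ _ → refl) (λ m → trans
               (⊛-cong {g = egf b} T≋ (λ _ → refl) m) (·-⊛ c⁻¹ (egf a) (egf b) m)) n) ⟩
        (1# - u) * (Ei∘degLog ⊛ (c⁻¹ · (egf a ⊛ egf b))) n
          -- `·-⊛` takes scalars out of a left factor only, hence the swap here and the swap back.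
          ≈⟨ *-congˡ (⊛-comm Ei∘degLog (c⁻¹ · (egf a ⊛ egf b)) n) ⟩
        (1# - u) * ((c⁻¹ · (egf a ⊛ egf b)) ⊛ Ei∘degLog) n
          ≈⟨ *-congˡ (·-⊛ c⁻¹ (egf a ⊛ egf b) Ei∘degLog n) ⟩
        (1# - u) * (c⁻¹ * ((egf a ⊛ egf b) ⊛ Ei∘degLog) n)
          ≈⟨ *-congˡ (*-congˡ (⊛-comm (egf a ⊛ egf b) Ei∘degLog n)) ⟩
        (1# - u) * (c⁻¹ * P)
          ∎

theorem5 : (lam : ℝ) (lam#0 : lam Real.# Real.0#) (k : ℤ) (u : ℂ) (u#1 : u # 1#) (x y : ℝ) (n : ℕ) →
    (fromℕ 2 * (∑[ l ≤ n ] (fromℕ (n C l) * falling lam 1# (n ∸ l) * FGᶜ lam lam#0 k u u#1 x y l)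
    - u * FGᶜ lam lam#0 k u u#1 x y n)
    ≈ (1# - u) * fromℕ n *
    ∑[ m < n ] (fromℚ (+ ((n ∸ 1) C m) / suc m)
    * ∑[ j ≤ m ] (falling lam 1# (suc j) * fromℚ 1/[ suc j ^ k -ℤ 1ℤ ] * S₁ lam lam#0 (suc m) (suc j))
    * ∑[ l ≤ n ∸ 1 ∸ m ] (fromℕ ((n ∸ 1 ∸ m) C l) * falling lam (fromℝ x) (n ∸ 1 ∸ m ∸ l)
    * (falling lam (i * fromℝ y) l + falling lam (- (i * fromℝ y)) l))))
    ×
    (fromℕ 2 * i * (∑[ l ≤ n ] (fromℕ (n C l) * falling lam 1# (n ∸ l) * FGˢ lam lam#0 k u u#1 x y l)
    - u * FGˢ lam lam#0 k u u#1 x y n)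
    ≈ (1# - u) * fromℕ n *
    ∑[ m < n ] (fromℚ (+ ((n ∸ 1) C m) / suc m)
    * ∑[ j ≤ m ] (falling lam 1# (suc j) * fromℚ 1/[ suc j ^ k -ℤ 1ℤ ] * S₁ lam lam#0 (suc m) (suc j))
    * ∑[ l ≤ n ∸ 1 ∸ m ] (fromℕ ((n ∸ 1 ∸ m) C l) * falling lam (fromℝ x) (n ∸ 1 ∸ m ∸ l)
    * (falling lam (i * fromℝ y) l - falling lam (- (i * fromℝ y)) l))))
theorem5 lam lam#0 k u u#1 x y n =
    -- The rational product of 2 and `½` evaluates to `1ℚ`, so multiplicativity of `fromℚ` already
    -- gives the inverse law.
    FG-identity lam lam#0 k u u#1 (fromℕ 2) (fromℚ ½) (sym (fromℚ-* (+ 2 / 1) ½))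
      (falling lam (fromℝ x)) (λ l → falling lam iy l + falling lam (- iy) l) (degCos lam y)
      (λ m → *-congˡ (egf-distrib-+ (falling lam iy) (falling lam (- iy)) m)) n
  , FG-identity lam lam#0 k u u#1 (fromℕ 2 * i) (inv (fromℕ 2 * i) 2i#0) (Complex.inv-inverseʳ (fromℕ 2 * i) 2i#0)
      (falling lam (fromℝ x)) (λ l → falling lam iy l - falling lam (- iy) l) (degSin lam y)
      (λ m → *-congˡ (egf-distrib-- (falling lam iy) (falling lam (- iy)) m)) n
  where
  iy : ℂ
  iy = i * fromℝ y
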